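{- Consider blind online service with per-batch maximum delay, and suppose one hidden request arrives at time zero and no request will arrive later (and the online algorithm is promised this). 1. On the three-point line $\{ -1,0,1\}$, with the server initially at $0$, every deterministic algorithm has competitive ratio at least $3$, and every randomized algorithm has competitive ratio at least $2$ against an oblivious adversary. 2. On a unit star with $d$ leaves, with the server initially at its center, every deterministic algorithm has competitive ratio at least $2d-1$, and every randomized algorithm has competitive ratio at least $d$ against an oblivious adversary. Both statements hold under elective and automatic service.
   Context: Model. $(X,\mathrm{dist})$ is a known finite metric space with initial server position $s_0\in X$. Each request $q$ has an arrival time $a(q)\ge 0$ and a location $x(q)\in X$. A walk $P=(v_0,\ldots,v_\ell)$ in $X$ ($\ell\ge 0$) is executed instantaneously at one time, visits its listed vertices, and has length $\operatorname{len}(P)=\sum_i \mathrm{dist}(v_{i-1},v_i)$. A schedule is a finite sequence of atomic actions with nondecreasing timestamps; at time $t$ arrivals at $t$ are processed first, and then an action at $t$ performs a finite ordered sequence of walks, chosen adaptively from observations made earlier. Consecutive walks are endpoint-continuous, starting at $s_0$. A walk $P$ at time $t$ during which a nonempty set $B$ of pending requests is served costs $\operatorname{len}(P)+\max_{q\in B}(t-a(q))$; a walk serving no request costs $\operatorname{len}(P)$. The cost is the sum of these costs; every request must eventually be served. Elective service: a visited pending request may, but need not, be served. Automatic service: every pending request whose location is visited is served in that event, and a request arriving at the current server position is served immediately. Blind information model: the algorithm learns that a request has arrived, its identity and its waiting time, but not its location. Visiting (or occupying) the location of a pending request reveals it. The unit star with $d$ leaves is the vertex set of the star graph with a center joined to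 $d$ leaves by edges of length one, with shortest-path distance (center–leaf distance $1$, leaf–leaf distance $2$). $\operatorname{OPT}(I)$ is the infimum cost of a clairvoyant offline schedule that knows all locations. The competitive ratio of an algorithm over the stated inputs is the infimum of $\rho$ such that $\operatorname{ALG}(I)\le\rho\operatorname{OPT}(I)$ (with $\mathbb{E}[\operatorname{ALG}(I)]$ for randomized algorithms) for every such input $I$; an oblivious adversary fixes the input before the algorithm's random choices. -}

module Defs where

open import Algebra.Bundles using (CommutativeRing)
open import Data.Bool.Base using (Bool; true; false; not; _∧_; if_then_else_; T)
open import Data.Fin.Base as Fin using (Fin; toℕ)
import Data.Fin.Properties as Fin
open import Data.Integer.Base as ℤ using (ℤ; +_; -[1+_])
import Data.Integer.Properties as ℤ
open import Data.List.Base using (List; []; _∷_; _++_; filterᵇ; foldr; length; map; upTo; zip)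
import Data.List.Extrema as Extrema
open import Data.List.Relation.Unary.All using (All)
open import Data.List.Relation.Unary.Linked using (Linked)
import Data.List.Membership.DecPropositional as DecMembership
open import Data.Maybe.Base using (Maybe; just; nothing)
open import Data.Nat.Base as ℕ using (ℕ; zero; suc; z≤n; s≤s)
import Data.Nat.Properties as ℕ
open import Data.Product.Base using (Σ; ∃; ∃-syntax; _×_; _,_; proj₁; proj₂)
open import Data.Sum.Base using (inj₁; inj₂)
open import Data.Unit.Base using (⊤)
open import Function.Base using (_∘_)
open import Function.Bundles using (_↔_; _⇔_; mk↔ₛ′)
open import Function.Properties.Inverse using (↔-sym; ↔⇒↣)
open import Function.Metric.Structures using (IsGeneralMetric)
open import Level using (0ℓ)
open import Relation.Binary.Bundles using (TotalOrder)
open import Relation.Binary.Core using (Rel)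
open import Relation.Binary.Definitions using (DecidableEquality)
open import Relation.Binary.PropositionalEquality as ≡ using (_≡_; _≢_)
open import Relation.Binary.Structures using (IsDecTotalOrder)
open import Relation.Nullary using (¬_; yes; no; does; contradiction)
open import Relation.Nullary.Decidable using (via-injection)
open import Relation.Unary using (Pred)

module Bounds {A : Set} (_≤_ : Rel A 0ℓ) where

  UpperBound LowerBound : Pred A 0ℓ → Pred A 0ℓ
  UpperBound S b = ∀ x → S x → x ≤ b
  LowerBound S b = ∀ x → S x → b ≤ x

  IsSupremum IsInfimum : Pred A 0ℓ → Pred A 0ℓ
  IsSupremum S s = UpperBound S s × (∀ b → UpperBound S b → s ≤ b)
  IsInfimum  S s = LowerBound S s × (∀ b → LowerBound S b → b ≤ s)

-- The library has no real numbers, so they enter as an arbitrary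
-- Dedekind-complete ordered field, which is ℝ up to isomorphism.  The order is
-- decidable, as it is classically.

record Reals : Set₁ where
  field
    commutativeRing : CommutativeRing 0ℓ 0ℓ

  open CommutativeRing commutativeRing public
    using (_≈_; _+_; _*_; _-_; -_; 0#; 1#)
    renaming (Carrier to ℝ)

  field
    _≤_             : Rel ℝ 0ℓ
    isDecTotalOrder : IsDecTotalOrder _≈_ _≤_
    0≉1             : ¬ 0# ≈ 1#
    inverse         : ∀ x → ¬ x ≈ 0# → ∃[ y ] x * y ≈ 1#
    +-monoˡ-≤       : ∀ {x y} z → x ≤ y → x + z ≤ y + z
    *-nonNegative   : ∀ {x y} → 0# ≤ x → 0# ≤ y → 0# ≤ x * y

  open Bounds _≤_ public

  field
    complete : ∀ S → ∃ S → ∃ (UpperBound S) → ∃ (IsSupremum S)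

  infix 4 _≤_ _<_

  _<_ : Rel ℝ 0ℓ
  x < y = ¬ y ≤ x

  totalOrder : TotalOrder 0ℓ 0ℓ 0ℓ
  totalOrder = record { isTotalOrder = IsDecTotalOrder.isTotalOrder isDecTotalOrder }

  open CommutativeRing commutativeRing using (+-rawMonoid; semiring)
  open import Algebra.Definitions.RawMonoid +-rawMonoid public using (sum)
  open import Algebra.Properties.Semiring.Mult semiring using ()
    renaming (_×_ to _×ᴿ_)

  fromℕ : ℕ → ℝ
  fromℕ n = n ×ᴿ 1#

record FiniteMetricSpace (𝓡 : Reals) : Set₁ where
  open Reals 𝓡
  field
    Point       : Set
    size        : ℕ
    enumeration : Fin size ↔ Point
    dist        : Point → Point → ℝ
    isMetric    : IsGeneralMetric _≡_ _≈_ _≤_ 0# _+_ dist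

  infix 4 _≟_
  _≟_ : DecidableEquality Point
  _≟_ = via-injection (↔⇒↣ (↔-sym enumeration)) Fin._≟_

data Service : Set where
  elective automatic : Service

module Model (𝓡 : Reals) (X : FiniteMetricSpace 𝓡)
             (s₀ : FiniteMetricSpace.Point X) where
  open Reals 𝓡
  open FiniteMetricSpace X
  open DecMembership _≟_ using (_∈?_)

  record Request : Set where
    constructor request
    field
      arrival  : ℝ
      location : Point
  open Request public

  record Instance : Set where
    field
      requests    : List Request
      nonNegative : All (λ q → 0# ≤ arrival q) requests
      ordered     : Linked (λ p q → arrival p ≤ arrival q) requests
  open Instance public

  -- A request together with its identity, its index in the instance.
  Tagged : Set
  Tagged = ℕ × Request

  -- `future` holds the requests that have not arrived yet.
  record State : Set where
    field
      clock    : ℝ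
      position : Point
      pending  : List Tagged
      future   : List Tagged
  open State public

  initial : Instance → State
  initial I = record
    { clock    = 0#
    ; position = s₀
    ; pending  = []
    ; future   = zip (upTo (length (requests I))) (requests I)
    }

  -- A walk (v₀, …, v_ℓ) is given by v₁, …, v_ℓ; its first vertex v₀ is the
  -- current position, so consecutive walks are endpoint-continuous.  An atomic
  -- action performing several walks is a run of walks with equal timestamps.
  Walk : Set
  Walk = List Point

  len : Point → Walk → ℝ
  len v []      = 0#
  len v (u ∷ w) = dist v u + len u w

  end : Point → Walk → Point
  end v []      = v
  end v (u ∷ w) = end u w

  -- Which requests to serve among those visited (by identity).
  Choice : Set
  Choice = ℕ → Bool

  visits : State → Walk → Tagged → Bool
  visits s w (_ , q) = does (location q ∈? (position s ∷ w))

  serves : Service → State → Walk → Choice → Tagged → Bool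
  serves elective  s w choice q = visits s w q ∧ choice (proj₁ q)
  serves automatic s w choice q = visits s w q

  -- Every pending request has t - a(q) ≥ 0, so the initial value 0# of the
  -- maximum matters only when no request is served.
  walkCost : Service → State → ℝ → Walk → Choice → ℝ
  walkCost σ s t w choice =
    len (position s) w
      + Extrema.max totalOrder 0#
          (map (λ q → t - arrival (proj₂ q)) (filterᵇ (serves σ s w choice) (pending s)))

  perform : Service → State → ℝ → Walk → Choice → State
  perform σ s t w choice = record
    { clock    = t
    ; position = end (position s) w
    ; pending  = filterᵇ (not ∘ serves σ s w choice) (pending s)
    ; future   = future s
    }

  occupied : State → Tagged → Bool
  occupied s (_ , q) = does (location q ≟ position s)

  servedOnArrival : Service → State → Tagged → Bool
  servedOnArrival elective  s q = false
  servedOnArrival automatic s q = occupied s q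

  admit : Service → State → Tagged → List Tagged → State
  admit σ s q later = record
    { clock    = arrival (proj₂ q)
    ; position = position s
    ; pending  = if servedOnArrival σ s q then pending s else pending s ++ (q ∷ [])
    ; future   = later
    }

  data Decision : Set where
    wait : Decision
    walk : ℝ → Walk → Decision

  -- A request is processed before a planned walk iff it arrives no later.
  Precedes : Tagged → Decision → Set
  Precedes q wait       = ⊤
  Precedes q (walk t _) = arrival (proj₂ q) ≤ t

  -- A clairvoyant offline schedule is a fixed list of steps, so each choice may
  -- depend on everything in the instance.
  record Step : Set where
    field
      time   : ℝ
      path   : Walk
      choice : Choice
  open Step public

  Schedule : Set
  Schedule = List Step

  firstStep : Schedule → Decision
  firstStep []      = wait
  firstStep (k ∷ _) = walk (time k) (path k)

  -- `Executes σ s P c`: from state s the schedule P is feasible, serves every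
  -- request, and costs c.
  data Executes (σ : Service) : State → Schedule → ℝ → Set where
    halt : ∀ {s} → pending s ≡ [] → future s ≡ [] → Executes σ s [] 0#
    arrive : ∀ {s P c q later} →
      future s ≡ q ∷ later → Precedes q (firstStep P) →
      Executes σ (admit σ s q later) P c → Executes σ s P c
    step : ∀ {s k P c} →
      clock s ≤ time k → All (λ q → time k < arrival (proj₂ q)) (future s) →
      Executes σ (perform σ s (time k) (path k) (choice k)) P c →
      Executes σ s (k ∷ P) (walkCost σ s (time k) (path k) (choice k) + c)

  IsOPT : Service → Instance → ℝ → Set
  IsOPT σ I = IsInfimum (λ c → ∃[ P ] Executes σ (initial I) P c)

  -- An arrival shows the identity and the arrival
  -- time; a location is shown only when the server occupies or visits it.

  data Observation : Set where
    arrived : ℕ → ℝ → Maybe Point → Observation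
    walked  : ℝ → Walk → List (ℕ × Point) → Observation

  -- Most recent observation first.
  History : Set
  History = List Observation

  observeArrival : State → Tagged → Observation
  observeArrival s q =
    arrived (proj₁ q) (arrival (proj₂ q))
      (if occupied s q then just (location (proj₂ q)) else nothing)

  observeWalk : State → ℝ → Walk → Observation
  observeWalk s t w =
    walked t w (map (λ q → proj₁ q , location (proj₂ q)) (filterᵇ (visits s w) (pending s)))

  -- After each observation the algorithm either plans its next walk, which is
  -- reconsidered if a request arrives by then, or waits for an arrival.  `serve`
  -- is consulted after the walk has been observed.
  record Algorithm : Set where
    field
      next  : History → Decision
      serve : History → Choice
  open Algorithm public

  -- `Runs σ A s h c`: from state s and history h the algorithm A eventually
  -- serves every request and stops, at total cost c.
  data Runs (σ : Service) (A : Algorithm) : State → History → ℝ → Set where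
    halt : ∀ {s h} →
      next A h ≡ wait → pending s ≡ [] → future s ≡ [] → Runs σ A s h 0#
    arrive : ∀ {s h c q later} →
      future s ≡ q ∷ later → Precedes q (next A h) →
      Runs σ A (admit σ s q later) (observeArrival s q ∷ h) c → Runs σ A s h c
    step : ∀ {s h t w c} →
      next A h ≡ walk t w →
      clock s ≤ t → All (λ q → t < arrival (proj₂ q)) (future s) →
      let h⁺     = observeWalk s t w ∷ h
          choice = serve A h⁺
      in Runs σ A (perform σ s t w choice) h⁺ c →
         Runs σ A s h (walkCost σ s t w choice + c)

  Cost : Service → Algorithm → Instance → ℝ → Set
  Cost σ A I = Runs σ A (initial I) []

  -- The set of ρ whose infimum is the competitive ratio on the given inputs.
  Competitive : Service → Pred Instance 0ℓ → Algorithm → Pred ℝ 0ℓ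
  Competitive σ Inputs A ρ =
    ∀ I → Inputs I → ∀ opt → IsOPT σ I opt →
    ∃[ c ] Cost σ A I c × c ≤ ρ * opt

  OneRequestAtZero : Pred Instance 0ℓ
  OneRequestAtZero I = ∃[ q ] requests I ≡ q ∷ [] × arrival q ≈ 0#

IsUnion : {Ω : Set} → (Ω → Bool) → (ℕ → Ω → Bool) → Set
IsUnion U A = ∀ ω → T (U ω) ⇔ (∃[ n ] T (A n ω))

-- Subsets of Ω are given by their indicator functions.  Values of ℙ outside
-- the σ-algebra `Event` are irrelevant.
record ProbabilitySpace (𝓡 : Reals) : Set₁ where
  open Reals 𝓡
  field
    Ω          : Set
    Event      : Pred (Ω → Bool) 0ℓ
    full       : Event (λ _ → true)
    complement : ∀ {A} → Event A → Event (not ∘ A)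
    union      : ∀ {A U} → (∀ n → Event (A n)) → IsUnion U A → Event U
    ℙ          : (Ω → Bool) → ℝ
    ℙ-nonNeg   : ∀ {A} → Event A → 0# ≤ ℙ A
    ℙ-full     : ℙ (λ _ → true) ≈ 1#
    ℙ-additive : ∀ {A U} → (∀ n → Event (A n)) →
                 (∀ {m n} → m ≢ n → ∀ ω → ¬ (T (A m ω) × T (A n ω))) →
                 IsUnion U A →
                 IsSupremum (λ x → ∃[ n ] x ≈ sum {n} (λ i → ℙ (A (toℕ i)))) (ℙ U)

  -- A random variable with values in [0, ∞]: `Z ω z` says that Z takes the
  -- finite value z at ω, and Z is ∞ where there is no such z.
  RandomVariable : Set₁
  RandomVariable = Ω → Pred ℝ 0ℓ

  Measurable : RandomVariable → Set
  Measurable Z =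
    ∀ x → ∃[ A ] Event A × (∀ ω → T (A ω) ⇔ (∃[ z ] Z ω z × z < x))

  -- Nonnegative simple functions Σᵢ aᵢ 1_{Aᵢ}.
  SimpleFunction : Set
  SimpleFunction = List (Σ (ℝ × (Ω → Bool)) λ (a , A) → 0# ≤ a × Event A)

  value : SimpleFunction → Ω → ℝ
  value φ ω = foldr (λ ((a , A) , _) v → (if A ω then a else 0#) + v) 0# φ

  integral : SimpleFunction → ℝ
  integral φ = foldr (λ ((a , A) , _) v → a * ℙ A + v) 0# φ

  -- The Lebesgue integral of Z exists, is finite and equals e.
  IsExpectation : RandomVariable → ℝ → Set
  IsExpectation Z e =
    Measurable Z ×
    IsSupremum (λ x → ∃[ φ ] (∀ ω z → Z ω z → value φ ω ≤ z) × x ≈ integral φ) e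

module Randomized (𝓡 : Reals) (X : FiniteMetricSpace 𝓡)
                  (s₀ : FiniteMetricSpace.Point X) where
  open Reals 𝓡
  open Model 𝓡 X s₀
  open ProbabilitySpace

  record RandomizedAlgorithm : Set₁ where
    field
      space     : ProbabilitySpace 𝓡
      algorithm : Ω space → Algorithm
  open RandomizedAlgorithm public

  -- The input is fixed before ω is drawn: the adversary is oblivious.
  CompetitiveInExpectation :
    Service → Pred Instance 0ℓ → RandomizedAlgorithm → Pred ℝ 0ℓ
  CompetitiveInExpectation σ Inputs A ρ =
    ∀ I → Inputs I → ∀ opt → IsOPT σ I opt →
    ∃[ e ] IsExpectation (space A) (λ ω → Cost σ (algorithm A ω) I) e × e ≤ ρ * opt

module NatMetric (𝓡 : Reals) where
  open Reals 𝓡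
  open CommutativeRing commutativeRing
    using (ring; semiring; +-comm; +-cong; +-congˡ; +-congʳ; +-identityˡ; +-identityʳ;
           -‿inverseˡ; -‿inverseʳ; *-identityˡ; +-assoc)
    renaming (refl to ≈-refl; sym to ≈-sym; trans to ≈-trans; reflexive to ≈-reflexive)
  open import Algebra.Properties.Ring ring using (-1*x≈-x; -‿involutive)
  open import Algebra.Properties.Semiring.Mult semiring using (×-homo-+)
  private module O = IsDecTotalOrder isDecTotalOrder

  0≤1 : 0# ≤ 1#
  0≤1 with O.total 0# 1#
  ... | inj₁ 0≤1 = 0≤1
  ... | inj₂ 1≤0 =
    O.≤-respʳ-≈ (≈-trans (-1*x≈-x (- 1#)) (-‿involutive 1#)) (*-nonNegative 0≤-1 0≤-1)
    where
    0≤-1 : 0# ≤ - 1#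
    0≤-1 = O.≤-respˡ-≈ (-‿inverseʳ 1#)
             (O.≤-respʳ-≈ (+-identityˡ (- 1#)) (+-monoˡ-≤ (- 1#) 1≤0))

  +-monoʳ-≤ : ∀ z {x y} → x ≤ y → z + x ≤ z + y
  +-monoʳ-≤ z {x} {y} x≤y =
    O.≤-respˡ-≈ (+-comm x z) (O.≤-respʳ-≈ (+-comm y z) (+-monoˡ-≤ z x≤y))

  fromℕ-nonNegative : ∀ n → 0# ≤ fromℕ n
  fromℕ-nonNegative zero    = O.refl
  fromℕ-nonNegative (suc n) =
    O.trans 0≤1 (O.≤-respˡ-≈ (+-identityʳ 1#) (+-monoʳ-≤ 1# (fromℕ-nonNegative n)))

  fromℕ-mono : ∀ {m n} → m ℕ.≤ n → fromℕ m ≤ fromℕ n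
  fromℕ-mono {n = n} z≤n = fromℕ-nonNegative n
  fromℕ-mono (s≤s m≤n)   = +-monoʳ-≤ 1# (fromℕ-mono m≤n)

  fromℕ≈0 : ∀ n → fromℕ n ≈ 0# → n ≡ 0
  fromℕ≈0 zero    _  = ≡.refl
  fromℕ≈0 (suc n) eq = contradiction (O.antisym 0≤1 1≤0) 0≉1
    where
    1≤0 : 1# ≤ 0#
    1≤0 = O.≤-respʳ-≈ eq
            (O.≤-respˡ-≈ (+-identityʳ 1#) (+-monoʳ-≤ 1# (fromℕ-nonNegative n)))

  fromℕ-isMetric : {P : Set} (d : P → P → ℕ) →
    (∀ x → d x x ≡ 0) → (∀ {x y} → d x y ≡ 0 → x ≡ y) →
    (∀ x y → d x y ≡ d y x) → (∀ x y z → d x z ℕ.≤ d x y ℕ.+ d y z) →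
    IsGeneralMetric _≡_ _≈_ _≤_ 0# _+_ (λ x y → fromℕ (d x y))
  fromℕ-isMetric d d-refl d-zero d-sym d-triangle = record
    { isSemiMetric = record
      { isQuasiSemiMetric = record
        { isPreMetric = record
          { isProtoMetric = record
            { isPartialOrder  = O.isPartialOrder
            ; ≈-isEquivalence = ≡.isEquivalence
            ; cong            = λ { ≡.refl ≡.refl → ≈-refl }
            ; nonNegative     = λ {x} {y} → fromℕ-nonNegative (d x y)
            }
          ; ≈⇒0 = λ { {x} ≡.refl → ≈-reflexive (≡.cong fromℕ (d-refl x)) }
          }
        ; 0⇒≈ = λ {x} {y} eq → d-zero (fromℕ≈0 (d x y) eq)
        }
      ; sym = λ x y → ≈-reflexive (≡.cong fromℕ (d-sym x y))
      }
    ; triangle = λ x y z →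
        O.≤-respʳ-≈ (×-homo-+ 1# (d x y) (d y z)) (fromℕ-mono (d-triangle x y z))
    }

data LinePoint : Set where
  minusOne origin plusOne : LinePoint

coordinate : LinePoint → ℤ
coordinate minusOne = -[1+ 0 ]
coordinate origin   = + 0
coordinate plusOne  = + 1

lineDist : LinePoint → LinePoint → ℕ
lineDist x y = ℤ.∣ coordinate x ℤ.- coordinate y ∣

line : (𝓡 : Reals) → FiniteMetricSpace 𝓡
line 𝓡 = record
  { Point       = LinePoint
  ; size        = 3
  ; enumeration = mk↔ₛ′ to from to-from from-to
  ; dist        = λ x y → Reals.fromℕ 𝓡 (lineDist x y)
  ; isMetric    = NatMetric.fromℕ-isMetric 𝓡 lineDist
      (λ x → ≡.cong ℤ.∣_∣ (ℤ.+-inverseʳ (coordinate x)))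
      (λ {x} {y} eq → coordinate-injective
         (ℤ.i-j≡0⇒i≡j (coordinate x) (coordinate y) (ℤ.∣i∣≡0⇒i≡0 eq)))
      (λ x y → ℤ.∣i-j∣≡∣j-i∣ (coordinate x) (coordinate y))
      (λ x y z → ≡.subst (λ i → ℤ.∣ i ∣ ℕ.≤ lineDist x y ℕ.+ lineDist y z)
         (ℤ.+-minus-telescope (coordinate x) (coordinate y) (coordinate z))
         (ℤ.∣i+j∣≤∣i∣+∣j∣ (coordinate x ℤ.- coordinate y) (coordinate y ℤ.- coordinate z)))
  }
  where
  to : Fin 3 → LinePoint
  to Fin.zero                       = minusOne
  to (Fin.suc Fin.zero)             = origin
  to (Fin.suc (Fin.suc Fin.zero))   = plusOne

  from : LinePoint → Fin 3
  from minusOne = Fin.zero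
  from origin   = Fin.suc Fin.zero
  from plusOne  = Fin.suc (Fin.suc Fin.zero)

  to-from : ∀ x → to (from x) ≡ x
  to-from minusOne = ≡.refl
  to-from origin   = ≡.refl
  to-from plusOne  = ≡.refl

  from-to : ∀ i → from (to i) ≡ i
  from-to Fin.zero                     = ≡.refl
  from-to (Fin.suc Fin.zero)           = ≡.refl
  from-to (Fin.suc (Fin.suc Fin.zero)) = ≡.refl

  coordinate-injective : ∀ {x y} → coordinate x ≡ coordinate y → x ≡ y
  coordinate-injective {minusOne} {minusOne} _ = ≡.refl
  coordinate-injective {origin}   {origin}   _ = ≡.refl
  coordinate-injective {plusOne}  {plusOne}  _ = ≡.refl

data StarPoint (d : ℕ) : Set where
  center : StarPoint d
  leaf   : Fin d → StarPoint d

starDist : ∀ {d} → StarPoint d → StarPoint d → ℕ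
starDist center   center   = 0
starDist center   (leaf _) = 1
starDist (leaf _) center   = 1
starDist (leaf i) (leaf j) = if does (i Fin.≟ j) then 0 else 2

unitStar : (𝓡 : Reals) → ℕ → FiniteMetricSpace 𝓡
unitStar 𝓡 d = record
  { Point       = StarPoint d
  ; size        = suc d
  ; enumeration = mk↔ₛ′ to from to-from from-to
  ; dist        = λ x y → Reals.fromℕ 𝓡 (starDist x y)
  ; isMetric    = NatMetric.fromℕ-isMetric 𝓡 starDist d-refl d-zero d-sym d-triangle
  }
  where
  to : Fin (suc d) → StarPoint d
  to Fin.zero    = center
  to (Fin.suc i) = leaf i

  from : StarPoint d → Fin (suc d)
  from center   = Fin.zero
  from (leaf i) = Fin.suc i

  to-from : ∀ x → to (from x) ≡ x
  to-from center   = ≡.refl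
  to-from (leaf i) = ≡.refl

  from-to : ∀ i → from (to i) ≡ i
  from-to Fin.zero    = ≡.refl
  from-to (Fin.suc i) = ≡.refl

  d-refl : (x : StarPoint d) → starDist x x ≡ 0
  d-refl center = ≡.refl
  d-refl (leaf i) with i Fin.≟ i
  ... | yes _  = ≡.refl
  ... | no i≢i = contradiction ≡.refl i≢i

  d-zero : {x y : StarPoint d} → starDist x y ≡ 0 → x ≡ y
  d-zero {center} {center} _ = ≡.refl
  d-zero {leaf i} {leaf j} _ with i Fin.≟ j
  ... | yes i≡j = ≡.cong leaf i≡j

  d-sym : (x y : StarPoint d) → starDist x y ≡ starDist y x
  d-sym center   center   = ≡.refl
  d-sym center   (leaf _) = ≡.refl
  d-sym (leaf _) center   = ≡.refl
  d-sym (leaf i) (leaf j) with i Fin.≟ j | j Fin.≟ i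
  ... | yes _   | yes _   = ≡.refl
  ... | no _    | no _    = ≡.refl
  ... | yes i≡j | no j≢i  = contradiction (≡.sym i≡j) j≢i
  ... | no i≢j  | yes j≡i = contradiction (≡.sym j≡i) i≢j

  d-triangle : (x y z : StarPoint d) → starDist x z ℕ.≤ starDist x y ℕ.+ starDist y z
  d-triangle center   y        center   = z≤n
  d-triangle center   center   (leaf _) = ℕ.≤-refl
  d-triangle center   (leaf _) (leaf _) = s≤s z≤n
  d-triangle (leaf _) center   center   = ℕ.≤-refl
  d-triangle (leaf i) (leaf j) center   = ℕ.m≤n+m 1 (starDist (leaf i) (leaf j))
  d-triangle (leaf i) center   (leaf k) with i Fin.≟ k
  ... | yes _ = z≤n
  ... | no _  = ℕ.≤-refl
  d-triangle (leaf i) (leaf j) (leaf k) with i Fin.≟ k | i Fin.≟ j | j Fin.≟ k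
  ... | yes _  | _       | _       = z≤n
  ... | no _   | no _    | _       = s≤s (s≤s z≤n)
  ... | no _   | yes _   | no _    = ℕ.≤-refl
  ... | no i≢k | yes i≡j | yes j≡k = contradiction (≡.trans i≡j j≡k) i≢k

{-# OPTIONS --safe #-}
module Submission where

-- The three-point line is the unit star with two leaves.  Until it visits the
-- leaf holding the request, a blind algorithm learns nothing, so all inputs
-- share one exploration of the star.  The first leaf found is reached after
-- length at least 1 and each further one after at least 2 more, so some order
-- of the leaves has costs at least 1, 3, …, 2d - 1, while OPT is 1 for every
-- leaf.  The last leaf gives the deterministic bound.  The costs add up to at
-- least 1 + 3 + … + (2d - 1) = d², hence so do the expected costs, and comparing
-- with d ρ gives the randomized bound.

open import Defs
open import Algebra.Bundles using (CommutativeRing)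
open import Data.Bool.Base using (Bool; true; false; not; _∧_; if_then_else_; T)
open import Data.Fin.Base using (Fin; zero; suc; toℕ; fromℕ<)
open import Data.Bool.Properties using (T-≡)
import Data.Fin.Properties as Fin
open import Data.List.Base
  using (List; []; _∷_; _++_; allFin; concatMap; filterᵇ; foldr; length; map)
import Data.List.Extrema as Extrema
open import Data.List.Properties using (filter-accept; filter-reject; length-tabulate)
import Data.List.Membership.DecPropositional as DecMembership
open import Data.List.Membership.Propositional using (_∈_; _∉_; find; lose)
open import Data.List.Membership.Propositional.Properties using (∈-∃++)
open import Data.List.Relation.Binary.Permutation.Propositional
  using (_↭_; refl; prep; swap; trans; ↭-refl; ↭-sym; ↭-trans; ↭⇒↭ₛ)
open import Data.List.Relation.Binary.Permutation.Propositional.Properties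
  using (shift; ∈-resp-↭; ↭-length)
import Data.List.Relation.Binary.Permutation.Setoid.Properties as Setoid↭
open import Data.List.Relation.Binary.Subset.Propositional using (_⊆_)
open import Data.List.Relation.Unary.All as All using (All; []; _∷_)
import Data.List.Relation.Unary.AllPairs as AllPairs
open import Data.List.Relation.Unary.Any using (here; there; any?)
open import Data.List.Relation.Unary.Linked using ([-])
open import Data.List.Relation.Unary.Unique.Propositional using (Unique)
open import Data.List.Relation.Unary.Unique.Propositional.Properties using (allFin⁺)
open import Data.Maybe.Base using (just; nothing)
open import Data.Nat.Base as ℕ using (ℕ; zero; suc; NonZero)
import Data.Nat.Properties as ℕ
open import Data.Nat.Tactic.RingSolver using (solve-∀)
open import Data.Product.Base using (∃-syntax; _×_; _,_; proj₁; proj₂)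
open import Data.Sum.Base using (_⊎_; inj₁; inj₂; [_,_]′)
open import Data.Unit.Base using (tt)
open import Function.Base using (id; _∘_)
open import Function.Bundles using (_⇔_; mk⇔; Equivalence)
open import Function.Metric.Structures using (IsGeneralMetric)
open import Relation.Binary.Bundles using (Poset)
open import Relation.Binary.PropositionalEquality as ≡ using (_≡_; _≢_)
open import Relation.Binary.Structures using (IsDecTotalOrder)
open import Relation.Nullary using (¬_; yes; no; contradiction)
open import Relation.Nullary.Decidable using (T?; dec-false; dec-true)
import Algebra.Properties.Semiring.Mult
import Algebra.Properties.CommutativeSemigroup
import Algebra.Solver.Ring.NaturalCoefficients.Default
import Relation.Binary.Reasoning.PartialOrder

-- The order of the leaves depends on the random outcome, and nothing says that it does so
-- measurably, so the costs cannot simply be added and then integrated. An expectation is a supremum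
-- over simple functions below the cost. Each cost is therefore replaced by a step function built
-- from the events "cost below 2n + 1", which measurability provides for every leaf separately. The
-- sum of these is one simple function, and only its pointwise bound d² uses the order found at each
-- outcome. Only walk lengths are charged, never delays, and whatever follows the first visit to the
-- request is merely nonnegative. This lets one argument cover elective and automatic service.

-- Ranked lists and Boolean auxiliaries

-- The entry at place j of the list satisfies `Q` with rank k + j. With `Q i n` saying that leaf `i`
-- costs at least 2n + 1, this is an order of the leaves with costs at least 1, 3, 5, ....
data Staircase {I : Set} (Q : I → ℕ → Set) : ℕ → List I → Set where
  []  : ∀ {k} → Staircase Q k []
  _∷_ : ∀ {k i is} → Q i k → Staircase Q (suc k) is → Staircase Q k (i ∷ is)

module _ {I : Set} {Q : I → ℕ → Set} where

  universal : (∀ {i n} → Q i n) → ∀ {k} is → Staircase Q k is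
  universal q []       = []
  universal q (i ∷ is) = q ∷ universal q is

  -- Membership is what tells that a leaf was missed by a walk; the bound on the rank keeps the
  -- levels of the randomized argument within a finite range.
  mapWith∈ : ∀ {P : I → ℕ → Set} {k is} →
    (∀ {i n} → i ∈ is → n ℕ.< k ℕ.+ length is → P i n → Q i n) →
    Staircase P k is → Staircase Q k is
  mapWith∈ f [] = []
  mapWith∈ {k = k} {is = _ ∷ is} f (p ∷ ps) =
    f (here ≡.refl) (≡.subst (k ℕ.<_) (≡.sym (ℕ.+-suc k _)) (ℕ.s≤s (ℕ.m≤m+n k _))) p
    ∷ mapWith∈ (λ {i} {n} i∈is n< →
        f (there i∈is) (≡.subst (n ℕ.<_) (≡.sym (ℕ.+-suc k (length is))) n<)) ps

  last : ∀ {k i is} → Staircase Q k (i ∷ is) → ∃[ j ] Q j (k ℕ.+ length is)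
  last {k} {i} (q ∷ []) = i , ≡.subst (Q i) (≡.sym (ℕ.+-identityʳ k)) q
  last {k} (_ ∷ qs@(_∷_ {is = is} _ _)) with j , q ← last qs =
    j , ≡.subst (Q j) (≡.sym (ℕ.+-suc k (length is))) q

Unique-resp-↭ : ∀ {I : Set} {is js : List I} → is ↭ js → Unique is → Unique js
Unique-resp-↭ {I} is↭js = Setoid↭.Unique-resp-↭ (≡.setoid I) (↭⇒↭ₛ is↭js)

module _ {A : Set} (p : A → Bool) {x : A} where

  filterᵇ-true : p x ≡ true → filterᵇ p (x ∷ []) ≡ x ∷ []
  filterᵇ-true px≡ = filter-accept (T? ∘ p) (Equivalence.from T-≡ px≡)

  filterᵇ-false : p x ≡ false → filterᵇ p (x ∷ []) ≡ []
  filterᵇ-false px≡ = filter-reject (T? ∘ p) (λ px → ≡.subst T px≡ px)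

bounded : ∀ {n} (f : Fin n → ℕ) → ∃[ N ] (∀ i → f i ℕ.≤ N)
bounded {zero}  f = 0 , λ ()
bounded {suc n} f with N , f≤N ← bounded (λ i → f (suc i)) =
  f zero ℕ.⊔ N , λ
    { zero    → ℕ.m≤m⊔n (f zero) N
    ; (suc i) → ℕ.≤-trans (f≤N i) (ℕ.m≤n⊔m (f zero) N) }

-- Makes a number that exists only under a condition total, with default 0, so that it can enter a
-- finite maximum.
ifT : ∀ b → (T b → ℕ) → ℕ
ifT true  f = f tt
ifT false f = 0

≤ifT : ∀ b f (t : T b) → f t ℕ.≤ ifT b f
≤ifT true f tt = ℕ.≤-refl

T-not⇔ : ∀ {b} → T (not b) ⇔ (¬ T b)
T-not⇔ {true}  = mk⇔ (λ ()) (λ ¬t → ¬t tt)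
T-not⇔ {false} = mk⇔ (λ _ ()) (λ _ → tt)

-- Arithmetic in the ordered field and sums of odd numbers

module OrderedField (𝓡 : Reals) where
  open Reals 𝓡
  open CommutativeRing commutativeRing public
    using (+-comm; +-assoc; +-cong; +-congˡ; +-congʳ; +-identityˡ; +-identityʳ;
           *-comm; *-congˡ; *-identityˡ; *-identityʳ; zeroˡ; zeroʳ;
           distribˡ; distribʳ; -‿inverseˡ; -‿inverseʳ; semiring;
           commutativeSemiring; +-commutativeSemigroup)
    renaming (refl to ≈-refl; sym to ≈-sym; trans to ≈-trans; reflexive to ≈-reflexive)
  open Algebra.Properties.Semiring.Mult semiring public using (×-homo-+; ×1-homo-*)
  open NatMetric 𝓡 public using (0≤1; +-monoʳ-≤; fromℕ-nonNegative; fromℕ-mono)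
  open IsDecTotalOrder isDecTotalOrder public
    using (≤-respˡ-≈; ≤-respʳ-≈; isPartialOrder)
    renaming (refl to ≤-refl; trans to ≤-trans; reflexive to ≤-reflexive;
              total to ≤-total; antisym to ≤-antisym; _≤?_ to infix 4 _≤?_)

  poset : Poset _ _ _
  poset = record { isPartialOrder = isPartialOrder }

  module ≤-Reasoning = Relation.Binary.Reasoning.PartialOrder poset
  open ≤-Reasoning
  open Algebra.Properties.CommutativeSemigroup +-commutativeSemigroup public
    using (interchange; x∙yz≈y∙xz)
  open Algebra.Solver.Ring.NaturalCoefficients.Default commutativeSemiring public
    using (solve; _:=_; _:+_; _:*_)

  +-mono-≤ : ∀ {x y u v} → x ≤ y → u ≤ v → x + u ≤ y + v
  +-mono-≤ {y = y} {u} x≤y u≤v = ≤-trans (+-monoˡ-≤ u x≤y) (+-monoʳ-≤ y u≤v)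

  x≤x+y : ∀ {x y} → 0# ≤ y → x ≤ x + y
  x≤x+y {x} 0≤y = ≤-respˡ-≈ (+-identityʳ x) (+-monoʳ-≤ x 0≤y)

  x≤y+x : ∀ {x y} → 0# ≤ y → x ≤ y + x
  x≤y+x {x} {y} 0≤y = ≤-respʳ-≈ (+-comm x y) (x≤x+y 0≤y)

  +-nonNegative : ∀ {x y} → 0# ≤ x → 0# ≤ y → 0# ≤ x + y
  +-nonNegative 0≤x 0≤y = ≤-trans 0≤x (x≤x+y 0≤y)

  +-cancelˡ-≤ : ∀ x {y z} → x + y ≤ x + z → y ≤ z
  +-cancelˡ-≤ x {y} {z} x+y≤x+z = begin
    y              ≈⟨ cancel y ⟨
    - x + (x + y)  ≤⟨ +-monoʳ-≤ (- x) x+y≤x+z ⟩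
    - x + (x + z)  ≈⟨ cancel z ⟩
    z              ∎
    where
    cancel : ∀ u → - x + (x + u) ≈ u
    cancel u = ≈-trans (≈-sym (+-assoc (- x) x u))
                 (≈-trans (+-congʳ (-‿inverseˡ x)) (+-identityˡ u))

  *-monoˡ-≤ : ∀ {x y z} → 0# ≤ x → y ≤ z → x * y ≤ x * z
  *-monoˡ-≤ {x} {y} {z} 0≤x y≤z = begin
    x * y                ≤⟨ x≤x+y (*-nonNegative 0≤x 0≤z-y) ⟩
    x * y + x * (z - y)  ≈⟨ distribˡ x y (z - y) ⟨
    x * (y + (z - y))    ≈⟨ *-congˡ y+z-y≈z ⟩
    x * z                ∎
    where
    0≤z-y : 0# ≤ z - y
    0≤z-y = ≤-respˡ-≈ (-‿inverseʳ y) (+-monoˡ-≤ (- y) y≤z)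
    y+z-y≈z : y + (z - y) ≈ z
    y+z-y≈z = ≈-trans (+-comm y (z - y)) (≈-trans (+-assoc z (- y) y)
                (≈-trans (+-congˡ (-‿inverseˡ y)) (+-identityʳ z)))

  *-monoʳ-≤ : ∀ {x y z} → 0# ≤ x → y ≤ z → y * x ≤ z * x
  *-monoʳ-≤ {x} {y} {z} 0≤x y≤z =
    ≤-respˡ-≈ (*-comm x y) (≤-respʳ-≈ (*-comm x z) (*-monoˡ-≤ 0≤x y≤z))

  fromℕ-+ : ∀ m n → fromℕ (m ℕ.+ n) ≈ fromℕ m + fromℕ n
  fromℕ-+ = ×-homo-+ 1#

  fromℕ-* : ∀ m n → fromℕ (m ℕ.* n) ≈ fromℕ m * fromℕ n
  fromℕ-* = ×1-homo-*

  odd : ℕ → ℝ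
  odd n = fromℕ (suc (n ℕ.+ n))

  odd-suc : ∀ n → odd (suc n) ≈ odd n + fromℕ 2
  odd-suc n = ≈-trans (≈-reflexive (≡.cong fromℕ (add-two n))) (fromℕ-+ (suc (n ℕ.+ n)) 2)
    where
    add-two : ∀ n → suc (suc n ℕ.+ suc n) ≡ suc (n ℕ.+ n) ℕ.+ 2
    add-two = solve-∀

  odd-mono : ∀ {k n} → k ℕ.≤ n → odd k ≤ odd n
  odd-mono k≤n = fromℕ-mono (ℕ.s≤s (ℕ.+-mono-≤ k≤n k≤n))

  square+odd : ∀ k → fromℕ (k ℕ.* k) + odd k ≈ fromℕ (suc k ℕ.* suc k)
  square+odd k = ≈-trans (≈-sym (fromℕ-+ (k ℕ.* k) (suc (k ℕ.+ k))))
    (≈-reflexive (≡.cong fromℕ (square k)))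
    where
    square : ∀ k → k ℕ.* k ℕ.+ suc (k ℕ.+ k) ≡ suc k ℕ.* suc k
    square = solve-∀

  module _ {I : Set} where

    sumOver : (I → ℝ) → List I → ℝ
    sumOver f = foldr (λ i v → f i + v) 0#

    sumOver-↭ : ∀ f {is js} → is ↭ js → sumOver f is ≈ sumOver f js
    sumOver-↭ f refl         = ≈-refl
    sumOver-↭ f (prep i p)   = +-congˡ (sumOver-↭ f p)
    sumOver-↭ f (swap {is} {js} i j p) = begin-equality
      f i + (f j + sumOver f is)  ≈⟨ x∙yz≈y∙xz (f i) (f j) _ ⟩
      f j + (f i + sumOver f is)  ≈⟨ +-congˡ (+-congˡ (sumOver-↭ f p)) ⟩
      f j + (f i + sumOver f js)  ∎
    sumOver-↭ f (trans p q)  = ≈-trans (sumOver-↭ f p) (sumOver-↭ f q)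

    sumOver≤ : ∀ {f ρ} → (∀ i → f i ≤ ρ) → ∀ is → sumOver f is ≤ fromℕ (length is) * ρ
    sumOver≤ {f} {ρ} f≤ρ []       = ≤-reflexive (≈-sym (zeroˡ ρ))
    sumOver≤ {f} {ρ} f≤ρ (i ∷ is) = begin
      f i + sumOver f is                   ≤⟨ +-mono-≤ (f≤ρ i) (sumOver≤ f≤ρ is) ⟩
      ρ + fromℕ (length is) * ρ            ≈⟨ +-congʳ (*-identityˡ ρ) ⟨
      1# * ρ + fromℕ (length is) * ρ       ≈⟨ distribʳ ρ 1# _ ⟨
      fromℕ (suc (length is)) * ρ          ∎

    sumOver-concatMap : ∀ {A : Set} (h : List A → ℝ) → h [] ≈ 0# →
      (∀ xs ys → h (xs ++ ys) ≈ h xs + h ys) →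
      ∀ (f : I → List A) is → h (concatMap f is) ≈ sumOver (λ i → h (f i)) is
    sumOver-concatMap h h[] h++ f []       = h[]
    sumOver-concatMap h h[] h++ f (i ∷ is) =
      ≈-trans (h++ (f i) _) (+-congˡ (sumOver-concatMap h h[] h++ f is))

    -- The ranks contribute consecutive odd numbers, and k² + (2k + 1) = (k + 1)². The term k² on
    -- the right stands for the ranks below `k` and carries the induction.
    sumOver-staircase : ∀ f {k is} → Staircase (λ i n → odd n ≤ f i) k is →
      fromℕ ((k ℕ.+ length is) ℕ.* (k ℕ.+ length is)) ≤ fromℕ (k ℕ.* k) + sumOver f is
    sumOver-staircase f {k} [] = begin
      fromℕ ((k ℕ.+ 0) ℕ.* (k ℕ.+ 0))  ≡⟨ ≡.cong (λ l → fromℕ (l ℕ.* l)) (ℕ.+-identityʳ k) ⟩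
      fromℕ (k ℕ.* k)                  ≈⟨ +-identityʳ _ ⟨
      fromℕ (k ℕ.* k) + 0#             ∎
    sumOver-staircase f {k} (_∷_ {i = i} {is} odd≤ stairs) = begin
      fromℕ ((k ℕ.+ suc (length is)) ℕ.* (k ℕ.+ suc (length is)))
        ≡⟨ ≡.cong (λ l → fromℕ (l ℕ.* l)) (ℕ.+-suc k (length is)) ⟩
      fromℕ (suc (k ℕ.+ length is) ℕ.* suc (k ℕ.+ length is))
        ≤⟨ sumOver-staircase f stairs ⟩
      fromℕ (suc k ℕ.* suc k) + sumOver f is
        ≈⟨ +-congʳ (square+odd k) ⟨
      fromℕ (k ℕ.* k) + odd k + sumOver f is
        ≈⟨ +-assoc _ _ _ ⟩
      fromℕ (k ℕ.* k) + (odd k + sumOver f is)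
        ≤⟨ +-monoʳ-≤ _ (+-monoˡ-≤ _ odd≤) ⟩
      fromℕ (k ℕ.* k) + (f i + sumOver f is)
        ∎

  -- Cancels without dividing. If ρ ≤ d, with d = m + 1, then d² ≤ dρ = ρ + mρ ≤ ρ + md; subtracting
  -- md leaves d ≤ ρ.
  square-cancel : ∀ m {ρ} → fromℕ (suc m ℕ.* suc m) ≤ fromℕ (suc m) * ρ → fromℕ (suc m) ≤ ρ
  square-cancel m {ρ} square≤ with ≤-total (fromℕ (suc m)) ρ
  ... | inj₁ d≤ρ = d≤ρ
  ... | inj₂ ρ≤d = +-cancelˡ-≤ (fromℕ (m ℕ.* suc m)) (begin
    fromℕ (m ℕ.* suc m) + fromℕ (suc m)  ≈⟨ +-comm _ _ ⟩
    fromℕ (suc m) + fromℕ (m ℕ.* suc m)  ≈⟨ fromℕ-+ (suc m) (m ℕ.* suc m) ⟨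
    fromℕ (suc m ℕ.* suc m)              ≤⟨ square≤ ⟩
    fromℕ (suc m) * ρ                    ≈⟨ distribʳ ρ 1# (fromℕ m) ⟩
    1# * ρ + fromℕ m * ρ                 ≈⟨ +-congʳ (*-identityˡ ρ) ⟩
    ρ + fromℕ m * ρ                      ≤⟨ +-monoʳ-≤ ρ (*-monoˡ-≤ (fromℕ-nonNegative m) ρ≤d) ⟩
    ρ + fromℕ m * fromℕ (suc m)          ≈⟨ +-congˡ (fromℕ-* m (suc m)) ⟨
    ρ + fromℕ (m ℕ.* suc m)              ≈⟨ +-comm _ _ ⟩
    fromℕ (m ℕ.* suc m) + ρ              ∎)

-- Finite additivity and integrals of simple functions

module SimpleIntegrals (𝓡 : Reals) (S : ProbabilitySpace 𝓡) where
  open Reals 𝓡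
  open OrderedField 𝓡
  open ≤-Reasoning
  open ProbabilitySpace S

  Subset : Set
  Subset = Ω → Bool

  ∅ : Subset
  ∅ _ = false

  infixr 6 _∩_ _∖_
  _∩_ _∖_ : Subset → Subset → Subset
  (D ∩ E) ω = D ω ∧ E ω
  (D ∖ E) ω = D ω ∧ not (E ω)

  IsUnionOf : Subset → Subset → Subset → Set
  IsUnionOf U A B = ∀ ω → T (U ω) ⇔ (T (A ω) ⊎ T (B ω))

  pair : Subset → Subset → ℕ → Subset
  pair A B zero          = A
  pair A B (suc zero)    = B
  pair A B (suc (suc _)) = ∅

  pair-event : ∀ {A B} → Event A → Event B → ∀ n → Event (pair A B n)
  pair-event eA eB zero          = eA
  pair-event eA eB (suc zero)    = eB
  pair-event eA eB (suc (suc _)) = complement full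

  pair-union : ∀ {U A B} → IsUnionOf U A B → IsUnion U (pair A B)
  pair-union {U} {A} {B} U≡ ω = mk⇔ to′ from′
    where
    to′ : T (U ω) → ∃[ n ] T (pair A B n ω)
    to′ u with Equivalence.to (U≡ ω) u
    ... | inj₁ a = 0 , a
    ... | inj₂ b = 1 , b
    from′ : (∃[ n ] T (pair A B n ω)) → T (U ω)
    from′ (zero , a)     = Equivalence.from (U≡ ω) (inj₁ a)
    from′ (suc zero , b) = Equivalence.from (U≡ ω) (inj₂ b)

  event-union : ∀ {U A B} → Event A → Event B → IsUnionOf U A B → Event U
  event-union eA eB U≡ = union (pair-event eA eB) (pair-union U≡)

  -- De Morgan yields an indicator that agrees with `D ∩ E` only pointwise. `Event` is not assumed
  -- to respect pointwise equality, but `union` does, so the set is taken as a union with itself.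
  ∩-event : ∀ {D E} → Event D → Event E → Event (D ∩ E)
  ∩-event {D} {E} eD eE = event-union eDE eDE (λ ω → doubleNegation (D ω) (E ω))
    where
    deMorgan : ∀ d e → T (not (d ∧ e)) ⇔ (T (not d) ⊎ T (not e))
    deMorgan true  true  = mk⇔ inj₁ [ id , id ]′
    deMorgan true  false = mk⇔ inj₂ _
    deMorgan false e     = mk⇔ inj₁ _
    doubleNegation : ∀ d e → T (d ∧ e) ⇔ (T (not (not (d ∧ e))) ⊎ T (not (not (d ∧ e))))
    doubleNegation true  true  = mk⇔ inj₁ _
    doubleNegation true  false = mk⇔ inj₁ [ id , id ]′
    doubleNegation false e     = mk⇔ inj₁ [ id , id ]′
    eDE : Event (λ ω → not (not (D ω ∧ E ω)))
    eDE = complement (event-union (complement eD) (complement eE) (λ ω → deMorgan (D ω) (E ω)))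

  ∖-event : ∀ {D E} → Event D → Event E → Event (D ∖ E)
  ∖-event eD eE = ∩-event eD (complement eE)

  -- In the constant sequence of empty sets the partial sum of two terms is at most the supremum
  -- `ℙ ∅`.
  ℙ-∅ : ℙ ∅ ≈ 0#
  ℙ-∅ = ≤-antisym
    (+-cancelˡ-≤ (ℙ ∅) (begin
      ℙ ∅ + ℙ ∅         ≈⟨ +-congˡ (+-identityʳ _) ⟨
      ℙ ∅ + (ℙ ∅ + 0#)  ≤⟨ proj₁ supremum _ (2 , ≈-refl) ⟩
      ℙ ∅               ≈⟨ +-identityʳ _ ⟨
      ℙ ∅ + 0#          ∎))
    (ℙ-nonNeg (complement full))
    where
    supremum = ℙ-additive (λ _ → complement full) (λ _ _ ()) (λ _ → mk⇔ (λ ()) (λ ()))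

  ℙ-disjointUnion : ∀ {U A B} → Event A → Event B → (∀ ω → ¬ (T (A ω) × T (B ω))) →
    IsUnionOf U A B → ℙ U ≈ ℙ A + ℙ B
  ℙ-disjointUnion {U} {A} {B} eA eB disjoint U≡ = ≤-antisym
    (proj₂ supremum (ℙ A + ℙ B) (λ { x (n , x≈) → ≤-respˡ-≈ (≈-sym x≈) (partial≤ n) }))
    (begin
      ℙ A + ℙ B          ≈⟨ +-congˡ (+-identityʳ _) ⟨
      ℙ A + (ℙ B + 0#)   ≤⟨ proj₁ supremum _ (2 , ≈-refl) ⟩
      ℙ U                ∎)
    where
    pair-disjoint : ∀ {m n} → m ≢ n → ∀ ω → ¬ (T (pair A B m ω) × T (pair A B n ω))
    pair-disjoint {zero}        {zero}        m≢n ω _       = m≢n ≡.refl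
    pair-disjoint {zero}        {suc zero}    m≢n ω ab      = disjoint ω ab
    pair-disjoint {suc zero}    {zero}        m≢n ω (b , a) = disjoint ω (a , b)
    pair-disjoint {suc zero}    {suc zero}    m≢n ω _       = m≢n ≡.refl
    pair-disjoint {suc (suc _)} {_}           m≢n ω (() , _)
    pair-disjoint {zero}        {suc (suc _)} m≢n ω (_ , ())
    pair-disjoint {suc zero}    {suc (suc _)} m≢n ω (_ , ())
    supremum = ℙ-additive (pair-event eA eB) pair-disjoint (pair-union U≡)
    rest≈0 : ∀ n → sum {n} (λ _ → ℙ ∅) ≈ 0#
    rest≈0 zero    = ≈-refl
    rest≈0 (suc n) = ≈-trans (+-cong ℙ-∅ (rest≈0 n)) (+-identityʳ 0#)
    partial≤ : ∀ n → sum {n} (λ i → ℙ (pair A B (toℕ i))) ≤ ℙ A + ℙ B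
    partial≤ zero          = +-nonNegative (ℙ-nonNeg eA) (ℙ-nonNeg eB)
    partial≤ (suc zero)    = +-monoʳ-≤ _ (ℙ-nonNeg eB)
    partial≤ (suc (suc n)) = +-monoʳ-≤ _ (≤-reflexive (≈-trans (+-congˡ (rest≈0 n)) (+-identityʳ _)))

  -- A set without points need not be the indicator `∅` itself; but it is disjoint from itself,
  -- hence its probability equals its own double.
  ℙ-empty : ∀ {D} → Event D → (∀ ω → ¬ T (D ω)) → ℙ D ≈ 0#
  ℙ-empty {D} eD empty = ≤-antisym
    (+-cancelˡ-≤ (ℙ D) (begin
      ℙ D + ℙ D  ≈⟨ ℙ-disjointUnion eD eD (λ ω (d , _) → empty ω d)
                      (λ ω → mk⇔ inj₁ [ id , id ]′) ⟨
      ℙ D        ≈⟨ +-identityʳ _ ⟨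
      ℙ D + 0#   ∎))
    (ℙ-nonNeg eD)

  -- The intersection with A makes the lemma apply to each term of an integral.
  ℙ-split : ∀ {A D E} → Event A → Event D → Event E →
    ℙ (D ∩ A) ≈ ℙ ((D ∩ E) ∩ A) + ℙ ((D ∖ E) ∩ A)
  ℙ-split {A} {D} {E} eA eD eE = ℙ-disjointUnion
    (∩-event (∩-event eD eE) eA) (∩-event (∖-event eD eE) eA)
    (λ ω → exclusive (D ω) (E ω) (A ω)) (λ ω → cases (D ω) (E ω) (A ω))
    where
    exclusive : ∀ d e a → ¬ (T ((d ∧ e) ∧ a) × T ((d ∧ not e) ∧ a))
    exclusive true  true  a (_ , ())
    exclusive true  false a (() , _)
    exclusive false e     a (() , _)
    cases : ∀ d e a → T (d ∧ a) ⇔ (T ((d ∧ e) ∧ a) ⊎ T ((d ∧ not e) ∧ a))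
    cases true  true  a = mk⇔ inj₁ [ id , (λ ()) ]′
    cases true  false a = mk⇔ inj₂ [ (λ ()) , id ]′
    cases false e     a = mk⇔ (λ ()) [ id , id ]′

  -- The sets of a simple function may overlap, so induction along `φ` must split the domain at
  -- every term; hence an integral over a varying part `D`.
  integralOn : Subset → SimpleFunction → ℝ
  integralOn D φ = foldr (λ ((a , A) , _) v → a * ℙ (D ∩ A) + v) 0# φ

  integralOn-split : ∀ {D E} → Event D → Event E → ∀ φ →
    integralOn D φ ≈ integralOn (D ∩ E) φ + integralOn (D ∖ E) φ
  integralOn-split eD eE [] = ≈-sym (+-identityʳ 0#)
  integralOn-split {D} {E} eD eE (((a , A) , _ , eA) ∷ φ) = begin-equality
    a * ℙ (D ∩ A) + integralOn D φ
      ≈⟨ +-cong (*-congˡ (ℙ-split eA eD eE)) (integralOn-split eD eE φ) ⟩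
    a * (ℙ ((D ∩ E) ∩ A) + ℙ ((D ∖ E) ∩ A)) + (integralOn (D ∩ E) φ + integralOn (D ∖ E) φ)
      ≈⟨ +-congʳ (distribˡ _ _ _) ⟩
    a * ℙ ((D ∩ E) ∩ A) + a * ℙ ((D ∖ E) ∩ A) + (integralOn (D ∩ E) φ + integralOn (D ∖ E) φ)
      ≈⟨ interchange _ _ _ _ ⟩
    a * ℙ ((D ∩ E) ∩ A) + integralOn (D ∩ E) φ + (a * ℙ ((D ∖ E) ∩ A) + integralOn (D ∖ E) φ)
      ∎

  ℙ-∩∖ : ∀ {D E} → Event D → Event E → ℙ D ≈ ℙ (D ∩ E) + ℙ (D ∖ E)
  ℙ-∩∖ {D} {E} eD eE = ℙ-disjointUnion (∩-event eD eE) (∖-event eD eE)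
    (λ ω → exclusive (D ω) (E ω)) (λ ω → cases (D ω) (E ω))
    where
    exclusive : ∀ d e → ¬ (T (d ∧ e) × T (d ∧ not e))
    exclusive true  true  (_ , ())
    exclusive true  false (() , _)
    exclusive false e     (() , _)
    cases : ∀ d e → T d ⇔ (T (d ∧ e) ⊎ T (d ∧ not e))
    cases true  true  = mk⇔ inj₁ _
    cases true  false = mk⇔ inj₂ _
    cases false e     = mk⇔ (λ ()) [ id , id ]′

  -- The accumulator B collects the coefficients of the sets of φ already known
  -- to contain D.
  integralOn-lowerBound : ∀ {C B D} → Event D → ∀ φ →
    (∀ ω → T (D ω) → C ≤ B + value φ ω) → C * ℙ D ≤ B * ℙ D + integralOn D φ
  integralOn-lowerBound {C} {B} {D} eD [] C≤ with C ≤? B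
  ... | yes C≤B = ≤-respʳ-≈ (≈-sym (+-identityʳ _)) (*-monoʳ-≤ (ℙ-nonNeg eD) C≤B)
  -- A point of `D` would give `C ≤ B`, so `D` has no points and both sides vanish.
  ... | no  C≰B = begin
    C * ℙ D       ≈⟨ *-congˡ ℙD≈0 ⟩
    C * 0#        ≈⟨ zeroʳ C ⟩
    0#            ≈⟨ zeroʳ B ⟨
    B * 0#        ≈⟨ *-congˡ ℙD≈0 ⟨
    B * ℙ D       ≈⟨ +-identityʳ _ ⟨
    B * ℙ D + 0#  ∎
    where
    ℙD≈0 : ℙ D ≈ 0#
    ℙD≈0 = ℙ-empty eD (λ ω d → C≰B (≤-respʳ-≈ (+-identityʳ B) (C≤ ω d)))
  integralOn-lowerBound {C} {B} {D} eD (((a , A) , _ , eA) ∷ φ) C≤ = begin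
    C * ℙ D
      ≈⟨ *-congˡ (ℙ-∩∖ eD eA) ⟩
    C * (ℙ (D ∩ A) + ℙ (D ∖ A))
      ≈⟨ distribˡ _ _ _ ⟩
    C * ℙ (D ∩ A) + C * ℙ (D ∖ A)
      ≤⟨ +-mono-≤ (integralOn-lowerBound (∩-event eD eA) φ inside)
                  (integralOn-lowerBound (∖-event eD eA) φ outside) ⟩
    (B + a) * ℙ (D ∩ A) + integralOn (D ∩ A) φ + (B * ℙ (D ∖ A) + integralOn (D ∖ A) φ)
      ≈⟨ solve 6 (λ B a p q x y →
           (B :+ a) :* p :+ x :+ (B :* q :+ y) := B :* (p :+ q) :+ (a :* p :+ (x :+ y)))
           ≈-refl B a (ℙ (D ∩ A)) (ℙ (D ∖ A)) (integralOn (D ∩ A) φ) (integralOn (D ∖ A) φ) ⟩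
    B * (ℙ (D ∩ A) + ℙ (D ∖ A)) + (a * ℙ (D ∩ A) + (integralOn (D ∩ A) φ + integralOn (D ∖ A) φ))
      ≈⟨ +-cong (*-congˡ (ℙ-∩∖ eD eA)) (+-congˡ (integralOn-split eD eA φ)) ⟨
    B * ℙ D + (a * ℙ (D ∩ A) + integralOn D φ)
      ∎
    where
    inside : ∀ ω → T ((D ∩ A) ω) → C ≤ B + a + value φ ω
    inside ω da with D ω | A ω | C≤ ω
    ... | true | true | C≤′ = ≤-respʳ-≈ (≈-sym (+-assoc B a _)) (C≤′ tt)
    outside : ∀ ω → T ((D ∖ A) ω) → C ≤ B + value φ ω
    outside ω da with D ω | A ω | C≤ ω
    ... | true | false | C≤′ = ≤-respʳ-≈ (+-congˡ (+-identityˡ _)) (C≤′ tt)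

  integral-lowerBound : ∀ {C} φ → (∀ ω → C ≤ value φ ω) → C ≤ integral φ
  integral-lowerBound {C} φ C≤ = begin
    C
      ≈⟨ *-identityʳ C ⟨
    C * 1#
      ≈⟨ *-congˡ ℙ-full ⟨
    C * ℙ (λ _ → true)
      ≤⟨ integralOn-lowerBound full φ (λ ω _ → ≤-respʳ-≈ (≈-sym (+-identityˡ _)) (C≤ ω)) ⟩
    0# * ℙ (λ _ → true) + integralOn (λ _ → true) φ
      -- Intersection with the full set computes away, so `integralOn` over it is `integral` by
      -- definition.
      ≈⟨ ≈-trans (+-congʳ (zeroˡ _)) (+-identityˡ _) ⟩
    integral φ
      ∎

  value-++ : ∀ ω φ ψ → value (φ ++ ψ) ω ≈ value φ ω + value ψ ω
  value-++ ω []      ψ = ≈-sym (+-identityˡ _)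
  value-++ ω (_ ∷ φ) ψ = ≈-trans (+-congˡ (value-++ ω φ ψ)) (≈-sym (+-assoc _ _ _))

  integral-++ : ∀ φ ψ → integral (φ ++ ψ) ≈ integral φ + integral ψ
  integral-++ []      ψ = ≈-sym (+-identityˡ _)
  integral-++ (_ ∷ φ) ψ = ≈-trans (+-congˡ (integral-++ φ ψ)) (≈-sym (+-assoc _ _ _))

  -- With Eₙ = {Z ≥ 2n + 1}, `levels K` is the largest of the values 0, 1, 3, …, 2K + 1
  -- not exceeding Z: the simple function tested against the expectation of Z.
  module Levels (E : ℕ → Subset) (event : ∀ n → Event (E n)) where

    levels : ℕ → SimpleFunction
    levels zero    = ((1# , E 0) , 0≤1 , event 0) ∷ []
    levels (suc k) = ((fromℕ 2 , E (suc k)) , fromℕ-nonNegative 2 , event (suc k)) ∷ levels k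

    levels≤odd : ∀ k ω → value (levels k) ω ≤ odd k
    levels≤odd zero ω with E 0 ω
    ... | true  = ≤-refl
    ... | false = ≤-respˡ-≈ (≈-sym (+-identityˡ 0#)) (fromℕ-nonNegative 1)
    levels≤odd (suc k) ω = begin
      (if E (suc k) ω then fromℕ 2 else 0#) + value (levels k) ω
        ≤⟨ +-mono-≤ (indicator≤ (E (suc k) ω)) (levels≤odd k ω) ⟩
      fromℕ 2 + odd k  ≈⟨ +-comm _ _ ⟩
      odd k + fromℕ 2  ≈⟨ odd-suc k ⟨
      odd (suc k)      ∎
      where
      indicator≤ : ∀ b → (if b then fromℕ 2 else 0#) ≤ fromℕ 2
      indicator≤ true  = ≤-refl
      indicator≤ false = fromℕ-nonNegative 2

    -- The sets `E n` are not assumed nested: at the highest level containing `ω` the cap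
    -- `levels≤odd` suffices, whichever lower levels contain it.
    levels≤ : ∀ {ω z} → 0# ≤ z → (∀ n → T (E n ω) → odd n ≤ z) → ∀ k → value (levels k) ω ≤ z
    levels≤ {ω} 0≤z odd≤ zero with E 0 ω | odd≤ 0
    ... | true  | 1≤z = 1≤z tt
    ... | false | _   = ≤-respˡ-≈ (≈-sym (+-identityˡ 0#)) 0≤z
    levels≤ {ω} {z} 0≤z odd≤ (suc k) with E (suc k) ω | odd≤ (suc k)
    ... | true  | odd≤z = begin
      fromℕ 2 + value (levels k) ω  ≤⟨ +-monoʳ-≤ _ (levels≤odd k ω) ⟩
      fromℕ 2 + odd k               ≈⟨ +-comm _ _ ⟩
      odd k + fromℕ 2               ≈⟨ odd-suc k ⟨
      odd (suc k)                   ≤⟨ odd≤z tt ⟩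
      z                             ∎
    ... | false | _ = ≤-respˡ-≈ (≈-sym (+-identityˡ _)) (levels≤ 0≤z odd≤ k)

    -- The levels 0, ..., n are all active and add up to 1 + 2n; those above `n` add nothing
    -- negative.
    odd≤levels : ∀ {ω n} K → n ℕ.≤ K → (∀ k → k ℕ.≤ n → T (E k ω)) →
      odd n ≤ value (levels K) ω
    odd≤levels {ω} zero ℕ.z≤n above with E 0 ω | above 0 ℕ.z≤n
    ... | true | _ = ≤-refl
    odd≤levels {ω} {n} (suc K) n≤K above with ℕ.m≤n⇒m<n∨m≡n n≤K
    ... | inj₁ (ℕ.s≤s n≤K′) =
      ≤-trans (odd≤levels K n≤K′ above) (x≤y+x (indicator≥0 (E (suc K) ω)))
      where
      indicator≥0 : ∀ b → 0# ≤ (if b then fromℕ 2 else 0#)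
      indicator≥0 true  = fromℕ-nonNegative 2
      indicator≥0 false = ≤-refl
    ... | inj₂ ≡.refl with E (suc K) ω | above (suc K) ℕ.≤-refl
    ... | true | _ = begin
      odd (suc K)                   ≈⟨ odd-suc K ⟩
      odd K + fromℕ 2               ≈⟨ +-comm _ _ ⟩
      fromℕ 2 + odd K               ≤⟨ +-monoʳ-≤ _ (odd≤levels K ℕ.≤-refl below) ⟩
      fromℕ 2 + value (levels K) ω  ∎
      where
      below : ∀ k → k ℕ.≤ K → T (E k ω)
      below k k≤K = above k (ℕ.m≤n⇒m≤1+n k≤K)

-- Search among leaves at distance 1 from the start and at least 2 apart

module BlindSearch
  (𝓡 : Reals) (X : FiniteMetricSpace 𝓡) (s₀ : FiniteMetricSpace.Point X)
  (m : ℕ) (leaf : Fin (suc m) → FiniteMetricSpace.Point X)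
  (radius : ∀ (i : Fin (suc m)) →
     Reals._≈_ 𝓡 (FiniteMetricSpace.dist X s₀ (leaf i)) (Reals.1# 𝓡))
  (separated : ∀ {i j : Fin (suc m)} → ¬ i ≡ j →
     Reals._≤_ 𝓡 (Reals.fromℕ 𝓡 2) (FiniteMetricSpace.dist X (leaf i) (leaf j)))
  where
  open Reals 𝓡
  open FiniteMetricSpace X
  open OrderedField 𝓡
  open ≤-Reasoning
  open Model 𝓡 X s₀
  open DecMembership _≟_ using (_∈?_)
  open Extrema totalOrder using (max; max≤v⁺; f[⊥]≤f[argmax])
  open IsGeneralMetric isMetric using (triangle; ≈⇒0) renaming (nonNegative to dist-nonNegative)

  1≰0 : ¬ 1# ≤ 0#
  1≰0 1≤0 = 0≉1 (≤-antisym 0≤1 1≤0)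

  leaf≢s₀ : ∀ i → ¬ leaf i ≡ s₀
  leaf≢s₀ i leaf≡s₀ = 1≰0 (begin
    1#                ≈⟨ radius i ⟨
    dist s₀ (leaf i)  ≈⟨ ≈⇒0 (≡.sym leaf≡s₀) ⟩
    0#                ∎)

  leaf-injective : ∀ {i j} → leaf i ≡ leaf j → i ≡ j
  leaf-injective {i} {j} eq with i Fin.≟ j
  ... | yes i≡j = i≡j
  ... | no  i≢j = contradiction (begin
    1#                      ≤⟨ x≤x+y (fromℕ-nonNegative 1) ⟩
    fromℕ 2                 ≤⟨ separated i≢j ⟩
    dist (leaf i) (leaf j)  ≈⟨ ≈⇒0 eq ⟩
    0#                      ∎) 1≰0

  len-nonNegative : ∀ v w → 0# ≤ len v w
  len-nonNegative v []      = ≤-refl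
  len-nonNegative v (u ∷ w) = +-nonNegative dist-nonNegative (len-nonNegative u w)

  dist≤len+dist : ∀ v w p → dist v p ≤ len v w + dist (end v w) p
  dist≤len+dist v []      p = ≤-reflexive (≈-sym (+-identityˡ _))
  dist≤len+dist v (u ∷ w) p = begin
    dist v p                                  ≤⟨ triangle v u p ⟩
    dist v u + dist u p                       ≤⟨ +-monoʳ-≤ _ (dist≤len+dist u w p) ⟩
    dist v u + (len u w + dist (end u w) p)   ≈⟨ +-assoc _ _ _ ⟨
    dist v u + len u w + dist (end u w) p     ∎

  dist≤len : ∀ {p} v w → p ∈ v ∷ w → dist v p ≤ len v w
  dist≤len v w       (here p≡v) = ≤-respˡ-≈ (≈-sym (≈⇒0 (≡.sym p≡v))) (len-nonNegative v w)
  dist≤len {p} v (u ∷ w) (there p∈w) =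
    ≤-trans (triangle v u p) (+-monoʳ-≤ _ (dist≤len u w p∈w))

  Arrangement : (Fin (suc m) → ℕ → Set) → ℕ → List (Fin (suc m)) → Set
  Arrangement Q k S = ∃[ order ] order ↭ S × Staircase Q k order

  -- The invariant of the search. By the triangle inequality, moving the server adds at least as
  -- much to `L` as it takes from the distance; at a leaf of `S` the invariant becomes `odd k ≤ L`.
  Within : ℝ → Point → ℕ → List (Fin (suc m)) → Set
  Within L v k S = ∀ {i} → i ∈ S → odd k ≤ L + dist v (leaf i)

  -- L is the length travelled so far, k the number of leaves found so far, and
  -- S the list of leaves not found yet: each further leaf costs at least 2.
  search : ∀ {Q} w v L k S → Unique S → Within L v k S →
    (∀ {i n} → leaf i ∈ v ∷ w → odd n ≤ L + len v w → Q i n) →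
    (∀ {k S′} → Unique S′ → S′ ⊆ S → (∀ {i} → i ∈ S′ → leaf i ∉ v ∷ w) →
       Within (L + len v w) (end v w) k S′ → Arrangement Q k S′) →
    Arrangement Q k S
  -- `search` inspects the vertex `v`; `leave` crosses the next edge once `v` holds no leaf of `S`.
  -- `found` and `continue` treat the leaves met and the leaves missed by the whole walk. `found`
  -- grants the full length because a walk is charged in full even if it meets the leaf midway.
  leave : ∀ {Q} w v L k S → Unique S → Within L v k S →
    (∀ {i} → i ∈ S → ¬ leaf i ≡ v) →
    (∀ {i n} → leaf i ∈ v ∷ w → odd n ≤ L + len v w → Q i n) →
    (∀ {k S′} → Unique S′ → S′ ⊆ S → (∀ {i} → i ∈ S′ → leaf i ∉ v ∷ w) →
       Within (L + len v w) (end v w) k S′ → Arrangement Q k S′) →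
    Arrangement Q k S

  search w v L k S unique far found continue with any? (λ i → leaf i ≟ v) S
  ... | no none =
    leave w v L k S unique far (λ i∈S leaf≡v → none (lose i∈S leaf≡v)) found continue
  ... | yes some with i , i∈S , ≡.refl ← find some
      with ys , zs , ≡.refl ← ∈-∃++ i∈S =
    i ∷ order , ↭-trans (prep i order↭) (↭-sym (shift i ys zs)) , found (here ≡.refl) here≤ ∷ stairs
    where
    unique′ : Unique (i ∷ ys ++ zs)
    unique′ = Unique-resp-↭ (shift i ys zs) unique
    i≢ : ∀ {j} → j ∈ ys ++ zs → ¬ i ≡ j
    i≢ = All.lookup (AllPairs.head unique′)
    odd≤L : odd k ≤ L
    odd≤L = begin
      odd k           ≤⟨ far i∈S ⟩
      L + dist v v    ≈⟨ +-congˡ (≈⇒0 ≡.refl) ⟩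
      L + 0#          ≈⟨ +-identityʳ L ⟩
      L               ∎
    here≤ : odd k ≤ L + len v w
    here≤ = ≤-trans odd≤L (x≤x+y (len-nonNegative v w))
    rest : Arrangement _ (suc k) (ys ++ zs)
    rest = leave w v L (suc k) (ys ++ zs) (AllPairs.tail unique′)
      (λ {j} j∈ → begin
        odd (suc k)          ≈⟨ odd-suc k ⟩
        odd k + fromℕ 2      ≤⟨ +-mono-≤ odd≤L (separated (i≢ j∈)) ⟩
        L + dist v (leaf j)  ∎)
      (λ j∈ leaf≡ → i≢ j∈ (≡.sym (leaf-injective leaf≡)))
      found
      (λ unique S′⊆ → continue unique (λ j∈ → ∈-resp-↭ (↭-sym (shift i ys zs)) (there (S′⊆ j∈))))
    order  = proj₁ rest
    order↭ = proj₁ (proj₂ rest)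
    stairs = proj₂ (proj₂ rest)

  leave [] v L k S unique far elsewhere found continue =
    continue unique id (λ { i∈S (here leaf≡v) → elsewhere i∈S leaf≡v })
      (λ i∈S → ≤-respʳ-≈ (+-congʳ (≈-sym (+-identityʳ L))) (far i∈S))
  leave (u ∷ w) v L k S unique far elsewhere found continue =
    search w u (L + dist v u) k S unique
      (λ {i} i∈S → begin
        odd k                                ≤⟨ far i∈S ⟩
        L + dist v (leaf i)                  ≤⟨ +-monoʳ-≤ L (triangle v u (leaf i)) ⟩
        L + (dist v u + dist u (leaf i))     ≈⟨ +-assoc L _ _ ⟨
        L + dist v u + dist u (leaf i)       ∎)
      (λ i∈w odd≤ → found (there i∈w) (≤-respʳ-≈ (+-assoc L _ _) odd≤))
      (λ unique′ S′⊆S missed far′ → continue unique′ S′⊆S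
        (λ { i∈S (here leaf≡v) → elsewhere (S′⊆S i∈S) leaf≡v
           ; i∈S (there i∈w)   → missed i∈S i∈w })
        (λ i∈S → ≤-respʳ-≈ (+-congʳ (+-assoc L _ _)) (far′ i∈S)))

  -- The instance with one hidden request and its optimum

  -- The maximum delay starts from `0#`, so dropping it can only lower the cost.
  len≤walkCost : ∀ σ s t w choice → len (position s) w ≤ walkCost σ s t w choice
  len≤walkCost σ s t w choice = x≤x+y (f[⊥]≤f[argmax] {f = id} 0#
    (map (λ q → t - arrival (proj₂ q)) (filterᵇ (serves σ s w choice) (pending s))))

  walkCost-nonNegative : ∀ σ s t w choice → 0# ≤ walkCost σ s t w choice
  walkCost-nonNegative σ s t w choice =
    ≤-trans (len-nonNegative (position s) w) (len≤walkCost σ s t w choice)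

  hidden : ℝ → Point → Fin (suc m) → State
  hidden t v i = record
    { clock    = t
    ; position = v
    ; pending  = (0 , request 0# (leaf i)) ∷ []
    ; future   = []
    }

  -- Where the two service modes agree: an unvisited request is never served, and a visited one is
  -- served if chosen. A positive choice is thus demanded only when `b` is `true`.
  serves-visits : ∀ σ s w choice q b → choice (proj₁ q) ≡ true ⊎ b ≡ false →
    visits s w q ≡ b → serves σ s w choice q ≡ b
  serves-visits elective  s w choice q true  (inj₁ chosen) visits≡ = ≡.cong₂ _∧_ visits≡ chosen
  serves-visits elective  s w choice q false _ visits≡ = ≡.cong (_∧ choice (proj₁ q)) visits≡
  serves-visits automatic s w choice q b     _ visits≡ = visits≡

  perform-missed : ∀ σ {t v i} t′ w choice → leaf i ∉ v ∷ w →
    perform σ (hidden t v i) t′ w choice ≡ hidden t′ (end v w) i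
  perform-missed σ {t} {v} {i} t′ w choice missed =
    ≡.cong (λ ps → record { clock = t′ ; position = end v w ; pending = ps ; future = [] })
      (filterᵇ-true (not ∘ serves σ (hidden t v i) w choice)
        (≡.cong not (serves-visits σ (hidden t v i) w choice _ false (inj₂ ≡.refl)
          (dec-false (leaf i ∈? (v ∷ w)) missed))))

  -- Blindness: the right-hand side does not mention `i`, so all leaves missed so far share one
  -- history.
  observeWalk-missed : ∀ {t v i} t′ w → leaf i ∉ v ∷ w →
    observeWalk (hidden t v i) t′ w ≡ walked t′ w []
  observeWalk-missed {t} {v} {i} t′ w missed =
    ≡.cong (λ ps → walked t′ w (map (λ q → proj₁ q , location (proj₂ q)) ps))
      (filterᵇ-false (visits (hidden t v i) w) (dec-false (leaf i ∈? (v ∷ w)) missed))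

  single : Fin (suc m) → Instance
  single i = record
    { requests    = request 0# (leaf i) ∷ []
    ; nonNegative = ≤-refl ∷ []
    ; ordered     = [-]
    }

  single-atZero : ∀ i → OneRequestAtZero (single i)
  single-atZero i = request 0# (leaf i) , ≡.refl , ≈-refl

  admit-single : ∀ σ i →
    admit σ (initial (single i)) (0 , request 0# (leaf i)) [] ≡ hidden 0# s₀ i
  admit-single elective  i = ≡.refl
  admit-single automatic i =
    ≡.cong (λ b → record
      { clock    = 0#
      ; position = s₀
      ; pending  = if b then [] else (0 , request 0# (leaf i)) ∷ []
      ; future   = []
      }) (dec-false (leaf i ≟ s₀) (leaf≢s₀ i))

  firstHistory : History
  firstHistory = arrived 0 0# nothing ∷ []

  observeArrival-single : ∀ i →
    observeArrival (initial (single i)) (0 , request 0# (leaf i)) ∷ [] ≡ firstHistory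
  observeArrival-single i =
    ≡.cong (λ b → arrived 0 0# (if b then just (leaf i) else nothing) ∷ [])
      (dec-false (leaf i ≟ s₀) (leaf≢s₀ i))

  Executes-nonNegative : ∀ {σ s P c} → Executes σ s P c → 0# ≤ c
  Executes-nonNegative (halt _ _)     = ≤-refl
  Executes-nonNegative (arrive _ _ e) = Executes-nonNegative e
  Executes-nonNegative {σ} {s} (step {k = k} _ _ e) =
    +-nonNegative (walkCost-nonNegative σ s (time k) (path k) (choice k)) (Executes-nonNegative e)

  -- The request must be visited before the schedule can halt. The state enters through an equation
  -- because after a missed walk it is only provably, not definitionally, of the form `hidden`.
  dist≤Executes : ∀ {σ s P c t v i} → s ≡ hidden t v i → Executes σ s P c → dist v (leaf i) ≤ c
  dist≤Executes ≡.refl (halt () _)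
  dist≤Executes ≡.refl (arrive () _ _)
  dist≤Executes {σ} {t = t} {v} {i} ≡.refl (step {k = k} {c = c} _ _ e)
    with leaf i ∈? (v ∷ path k)
  ... | yes visited = begin
    dist v (leaf i)  ≤⟨ dist≤len v (path k) visited ⟩
    len v (path k)   ≤⟨ len≤walkCost σ (hidden t v i) (time k) (path k) (choice k) ⟩
    cost             ≤⟨ x≤x+y (Executes-nonNegative e) ⟩
    cost + c         ∎
    where cost = walkCost σ (hidden t v i) (time k) (path k) (choice k)
  ... | no missed = begin
    dist v (leaf i)                                  ≤⟨ dist≤len+dist v (path k) (leaf i) ⟩
    len v (path k) + dist (end v (path k)) (leaf i)
      ≤⟨ +-mono-≤ (len≤walkCost σ (hidden t v i) (time k) (path k) (choice k))
           (dist≤Executes (perform-missed σ (time k) (path k) (choice k) missed) e) ⟩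
    walkCost σ (hidden t v i) (time k) (path k) (choice k) + c  ∎

  OPT≥1 : ∀ {σ i P c} → Executes σ (initial (single i)) P c → 1# ≤ c
  OPT≥1 (halt _ ())
  OPT≥1 {σ} {i} (arrive ≡.refl _ e) =
    ≤-respˡ-≈ (radius i) (dist≤Executes (admit-single σ i) e)
  -- A walk before the arrival would need a time below `0#`, where the clock already stands.
  OPT≥1 (step 0≤t (t<0 ∷ _) _) = contradiction 0≤t t<0

  direct : Fin (suc m) → Step
  direct i = record { time = 0# ; path = leaf i ∷ [] ; choice = λ _ → true }

  perform-direct : ∀ σ i → pending (perform σ (hidden 0# s₀ i) 0# (leaf i ∷ []) (λ _ → true)) ≡ []
  perform-direct σ i =
    filterᵇ-false (not ∘ serves σ (hidden 0# s₀ i) (leaf i ∷ []) (λ _ → true))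
      (≡.cong not (serves-visits σ (hidden 0# s₀ i) (leaf i ∷ []) (λ _ → true) _ true (inj₁ ≡.refl)
        (dec-true (leaf i ∈? (s₀ ∷ leaf i ∷ [])) (there (here ≡.refl)))))

  Executes-direct : ∀ σ i {s} → s ≡ hidden 0# s₀ i →
    Executes σ s (direct i ∷ []) (walkCost σ s 0# (leaf i ∷ []) (λ _ → true) + 0#)
  Executes-direct σ i ≡.refl = step ≤-refl [] (halt (perform-direct σ i) ≡.refl)

  walkCost-direct : ∀ σ i {s} → s ≡ hidden 0# s₀ i →
    walkCost σ s 0# (leaf i ∷ []) (λ _ → true) + 0# ≤ 1#
  walkCost-direct σ i {s} ≡.refl = begin
    dist s₀ (leaf i) + 0# + delay + 0#  ≈⟨ +-identityʳ _ ⟩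
    dist s₀ (leaf i) + 0# + delay       ≈⟨ +-congʳ (+-identityʳ _) ⟩
    dist s₀ (leaf i) + delay            ≈⟨ +-congʳ (radius i) ⟩
    1# + delay                          ≤⟨ +-monoʳ-≤ 1# (max≤v⁺ {xs = delays} ≤-refl (all-zero chosen)) ⟩
    1# + 0#                             ≈⟨ +-identityʳ 1# ⟩
    1#                                  ∎
    where
    chosen = serves σ s (leaf i ∷ []) (λ _ → true)
    delays = map (λ q → 0# - arrival (proj₂ q)) (filterᵇ chosen (pending s))
    delay  = max 0# delays
    -- For an arbitrary `p`, since the delay at time `0#` vanishes whether or not the request is
    -- selected.
    all-zero : ∀ p → All (_≤ 0#) (map (λ q → 0# - arrival (proj₂ q)) (filterᵇ p (pending s)))
    all-zero p with p (0 , request 0# (leaf i))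
    ... | true  = ≤-reflexive (-‿inverseʳ 0#) ∷ []
    ... | false = []

  OPT≈1 : ∀ σ i → IsOPT σ (single i) 1#
  OPT≈1 σ i = (λ { c (_ , e) → OPT≥1 e }) ,
    λ b lower → ≤-trans
      (lower _ (direct i ∷ [] , arrive ≡.refl ≤-refl (Executes-direct σ i (admit-single σ i))))
      (walkCost-direct σ i (admit-single σ i))

  -- Runs of a blind algorithm on all leaves at once

  response : Algorithm → History → State → ℝ → Walk → Choice
  response A h s t w = serve A (observeWalk s t w ∷ h)

  Runs-nonNegative : ∀ {σ A s h c} → Runs σ A s h c → 0# ≤ c
  Runs-nonNegative (halt _ _ _)   = ≤-refl
  Runs-nonNegative (arrive _ _ r) = Runs-nonNegative r
  Runs-nonNegative {σ} {A} {s} {h} (step {t = t} {w} _ _ _ r) =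
    +-nonNegative (walkCost-nonNegative σ s t w (response A h s t w)) (Runs-nonNegative r)

  steps : ∀ {σ A s h c} → Runs σ A s h c → ℕ
  steps (halt _ _ _)   = 0
  steps (arrive _ _ r) = suc (steps r)
  steps (step _ _ _ r) = suc (steps r)

  -- Only runs of bounded length are considered, so that an algorithm which never
  -- finds some of the leaves needs no separate treatment.
  record CostsFrom (σ : Service) (A : Algorithm) (N : ℕ) (h : History) (v : Point) (L : ℝ)
                   (i : Fin (suc m)) (n : ℕ) : Set where
    field
      cost≥ : ∀ {s h′ t c} → s ≡ hidden t v i → h′ ≡ h →
              (r : Runs σ A s h′ c) → steps r ℕ.< N → odd n ≤ L + c
  open CostsFrom

  -- Induction on the step bound. If the algorithm waits, or no steps are left, no run qualifies and
  -- any order will do. If it walks, the leaves met are ranked by `search`; those missed share the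
  -- history `walked t′ w [] ∷ h`, so one recursive call orders them all.
  arrangement : ∀ σ A N h v L k S → Unique S → Within L v k S →
    Arrangement (CostsFrom σ A N h v L) k S
  arrangement σ A zero h v L k S unique far = S , ↭-refl , universal none S
    where
    none : ∀ {i n} → CostsFrom σ A zero h v L i n
    none .cost≥ _ _ _ ()
  arrangement σ A (suc N) h v L k S unique far with next A h in next≡
  ... | wait = S , ↭-refl , universal stuck S
    where
    stuck : ∀ {i n} → CostsFrom σ A (suc N) h v L i n
    stuck .cost≥ ≡.refl ≡.refl (halt _ () _)
    stuck .cost≥ ≡.refl ≡.refl (arrive () _ _)
    stuck .cost≥ ≡.refl ≡.refl (step eq _ _ _) with () ← ≡.trans (≡.sym next≡) eq
  ... | walk t′ w = search w v L k S unique far found continue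
    where
    -- The walk that meets the leaf already costs enough; an elective algorithm that declines to
    -- serve there only pays more.
    found : ∀ {i n} → leaf i ∈ v ∷ w → odd n ≤ L + len v w → CostsFrom σ A (suc N) h v L i n
    found _ _ .cost≥ ≡.refl ≡.refl (halt _ () _)
    found _ _ .cost≥ ≡.refl ≡.refl (arrive () _ _)
    found {i} _ odd≤ .cost≥ {t = t} ≡.refl ≡.refl (step eq _ _ r) _
      with ≡.refl ← ≡.trans (≡.sym next≡) eq =
      ≤-trans odd≤ (+-monoʳ-≤ L
        (≤-trans (len≤walkCost σ (hidden t v i) t′ w (response A h (hidden t v i) t′ w))
          (x≤x+y (Runs-nonNegative r))))

    missed : ∀ {i n} → leaf i ∉ v ∷ w →
      CostsFrom σ A N (walked t′ w [] ∷ h) (end v w) (L + len v w) i n →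
      CostsFrom σ A (suc N) h v L i n
    missed _ _ .cost≥ ≡.refl ≡.refl (halt _ () _)
    missed _ _ .cost≥ ≡.refl ≡.refl (arrive () _ _)
    missed {i} {n} i∉w later .cost≥ {t = t} ≡.refl ≡.refl (step {c = c} eq _ _ r) steps<
      with ≡.refl ← ≡.trans (≡.sym next≡) eq = begin
      odd n
        ≤⟨ later .cost≥ (perform-missed σ t′ w served i∉w)
             (≡.cong (_∷ h) (observeWalk-missed {t} t′ w i∉w)) r (ℕ.s<s⁻¹ steps<) ⟩
      L + len v w + c
        ≈⟨ +-assoc L _ c ⟩
      L + (len v w + c)
        ≤⟨ +-monoʳ-≤ L (+-monoˡ-≤ c (len≤walkCost σ (hidden t v i) t′ w served)) ⟩
      L + (walkCost σ (hidden t v i) t′ w served + c)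
        ∎
      where served = response A h (hidden t v i) t′ w

    continue : ∀ {k S′} → Unique S′ → S′ ⊆ S → (∀ {i} → i ∈ S′ → leaf i ∉ v ∷ w) →
      Within (L + len v w) (end v w) k S′ → Arrangement (CostsFrom σ A (suc N) h v L) k S′
    continue unique′ _ unseen far′
      with order , order↭ , stairs ←
        arrangement σ A N (walked t′ w [] ∷ h) (end v w) (L + len v w) _ _ unique′ far′ =
      order , order↭ , mapWith∈ (λ i∈ _ → missed (unseen (∈-resp-↭ order↭ i∈))) stairs

  record Costs (σ : Service) (A : Algorithm) (N : ℕ) (i : Fin (suc m)) (n : ℕ) : Set where
    field
      total≥ : ∀ {c} (r : Cost σ A (single i) c) → steps r ℕ.≤ N → odd n ≤ c
  open Costs

  arrangement₀ : ∀ σ A N → Arrangement (Costs σ A N) 0 (allFin (suc m))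
  arrangement₀ σ A N with order , order↭ , stairs ← arrangement σ A N firstHistory s₀ 0# 0
      (allFin (suc m)) (allFin⁺ (suc m)) (λ {i} _ → begin
        odd 0                  ≈⟨ +-identityʳ 1# ⟩
        1#                     ≈⟨ radius i ⟨
        dist s₀ (leaf i)       ≈⟨ +-identityˡ _ ⟨
        0# + dist s₀ (leaf i)  ∎) =
    order , order↭ , mapWith∈ (λ _ _ → atStart) stairs
    where
    atStart : ∀ {i n} → CostsFrom σ A N firstHistory s₀ 0# i n → Costs σ A N i n
    atStart _ .total≥ (halt _ _ ())
    -- The arrival uses up one step, so `steps≤` is by definition the strict bound that `cost≥`
    -- expects.
    atStart {i} later .total≥ {c} (arrive ≡.refl _ r) steps≤ =
      ≤-respʳ-≈ (+-identityˡ c)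
        (later .cost≥ (admit-single σ i) (observeArrival-single i) r steps≤)
    atStart _ .total≥ (step _ 0≤t (t<0 ∷ _) _) _ = contradiction 0≤t t<0

  deterministic : ∀ σ A → LowerBound (Competitive σ OneRequestAtZero A) (odd m)
  deterministic σ A ρ competitive = worst
    where
    outcome : ∀ i → ∃[ c ] Cost σ A (single i) c × c ≤ ρ * 1#
    outcome i = competitive (single i) (single-atZero i) 1# (OPT≈1 σ i)
    run : ∀ i → Cost σ A (single i) (proj₁ (outcome i))
    run i = proj₁ (proj₂ (outcome i))
    worst : odd m ≤ ρ
    -- Competitiveness provides a finite run for each leaf, and `N` bounds them all; the last leaf
    -- of the resulting order has rank `m`.
    worst with N , steps≤N ← bounded (λ i → steps (run i))
      with arrangement₀ σ A N
    ... | [] , order↭ , _ with () ← ↭-length order↭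
    ... | order@(_ ∷ is) , order↭ , stairs with i , costs ← last stairs = begin
      odd m              ≡⟨ ≡.cong odd length≡ ⟨
      odd (length is)    ≤⟨ costs .total≥ (run i) (steps≤N i) ⟩
      proj₁ (outcome i)  ≤⟨ proj₂ (proj₂ (outcome i)) ⟩
      ρ * 1#             ≈⟨ *-identityʳ ρ ⟩
      ρ                  ∎
      where
      length≡ : length is ≡ m
      length≡ = ℕ.suc-injective (≡.trans (↭-length order↭) (length-tabulate {n = suc m} id))

  -- The randomized bound

  open Randomized 𝓡 X s₀

  randomized : ∀ σ A → LowerBound (CompetitiveInExpectation σ OneRequestAtZero A) (fromℕ (suc m))
  randomized σ A ρ competitive = square-cancel m (begin
    fromℕ (suc m ℕ.* suc m)
      ≤⟨ integral-lowerBound (concatMap φ leaves) square≤value ⟩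
    integral (concatMap φ leaves)
      ≈⟨ sumOver-concatMap integral ≈-refl integral-++ φ leaves ⟩
    sumOver (λ i → integral (φ i)) leaves
      ≤⟨ sumOver≤ integral≤ρ leaves ⟩
    fromℕ (length leaves) * ρ
      ≡⟨ ≡.cong (λ l → fromℕ l * ρ) (length-tabulate {n = suc m} id) ⟩
    fromℕ (suc m) * ρ
      ∎)
    where
    open ProbabilitySpace (space A)
    open SimpleIntegrals 𝓡 (space A)

    leaves : List (Fin (suc m))
    leaves = allFin (suc m)

    Z : Fin (suc m) → RandomVariable
    Z i ω = Cost σ (algorithm A ω) (single i)

    expectation : ∀ i → ∃[ e ] IsExpectation (Z i) e × e ≤ ρ * 1#
    expectation i = competitive (single i) (single-atZero i) 1# (OPT≈1 σ i)

    measurable : ∀ i → Measurable (Z i)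
    measurable i = proj₁ (proj₁ (proj₂ (expectation i)))

    below : Fin (suc m) → ℕ → Subset
    below i n = proj₁ (measurable i (odd n))

    below⇔ : ∀ i n ω → T (below i n ω) ⇔ (∃[ z ] Z i ω z × z < odd n)
    below⇔ i n = proj₂ (proj₂ (measurable i (odd n)))

    -- The complement of "cost below 2n + 1" also contains the outcomes without a terminating run,
    -- where the cost is infinite.
    module L (i : Fin (suc m)) =
      Levels (λ n → not ∘ below i n) (λ n → complement (proj₁ (proj₂ (measurable i (odd n)))))

    φ : Fin (suc m) → SimpleFunction
    φ i = L.levels i m

    φ≤Z : ∀ i ω z → Z i ω z → value (φ i) ω ≤ z
    φ≤Z i ω z run = L.levels≤ i (Runs-nonNegative run) above m
      where
      above : ∀ n → T (not (below i n ω)) → odd n ≤ z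
      above n notBelow with odd n ≤? z
      ... | yes odd≤z = odd≤z
      ... | no  odd≰z = contradiction (Equivalence.from (below⇔ i n ω) (z , run , odd≰z))
                                      (Equivalence.to T-not⇔ notBelow)

    integral≤ρ : ∀ i → integral (φ i) ≤ ρ
    integral≤ρ i = begin
      integral (φ i)  ≤⟨ proj₁ (proj₂ (proj₁ (proj₂ (expectation i)))) _ (φ i , φ≤Z i , ≈-refl) ⟩
      _               ≤⟨ proj₂ (proj₂ (expectation i)) ⟩
      ρ * 1#          ≈⟨ *-identityʳ ρ ⟩
      ρ               ∎

    square≤value : ∀ ω → fromℕ (suc m ℕ.* suc m) ≤ value (concatMap φ leaves) ω
    square≤value ω = begin
      fromℕ (suc m ℕ.* suc m)
        ≡⟨ ≡.cong (λ l → fromℕ (l ℕ.* l)) length≡ ⟨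
      fromℕ (length order ℕ.* length order)
        ≤⟨ sumOver-staircase (λ i → value (φ i) ω) (mapWith∈ (λ _ → odd≤φ) stairs) ⟩
      0# + sumOver (λ i → value (φ i) ω) order
        ≈⟨ +-identityˡ _ ⟩
      sumOver (λ i → value (φ i) ω) order
        ≈⟨ sumOver-↭ _ order↭ ⟩
      sumOver (λ i → value (φ i) ω) leaves
        ≈⟨ sumOver-concatMap (λ ψ → value ψ ω) ≈-refl (value-++ ω) φ leaves ⟨
      value (concatMap φ leaves) ω
        ∎
      where
      run : ∀ i n → T (below i n ω) → ∃[ z ] Z i ω z × z < odd n
      run i n = Equivalence.to (below⇔ i n ω)

      -- The step bound must be chosen before the order. Only runs witnessing a cost below `odd n`
      -- with n ≤ m need to be covered, and these are finitely many; termination of the algorithm at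
      -- `ω` is never decided.
      stepsBelow : Fin (suc m) → ℕ → ℕ
      stepsBelow i n = ifT (below i n ω) (λ b → steps (proj₁ (proj₂ (run i n b))))

      levelBound : ∀ i → ∃[ N ] (∀ (n : Fin (suc m)) → stepsBelow i (toℕ n) ℕ.≤ N)
      levelBound i = bounded (stepsBelow i ∘ toℕ)

      leafBound : ∃[ N ] (∀ i → proj₁ (levelBound i) ℕ.≤ N)
      leafBound = bounded (proj₁ ∘ levelBound)

      N : ℕ
      N = proj₁ leafBound

      steps≤N : ∀ i n → n ℕ.< suc m → (b : T (below i n ω)) →
        steps (proj₁ (proj₂ (run i n b))) ℕ.≤ N
      steps≤N i n n< b = ℕ.≤-trans (≤ifT (below i n ω) _ b) (ℕ.≤-trans
        (≡.subst (λ k → stepsBelow i k ℕ.≤ proj₁ (levelBound i)) (Fin.toℕ-fromℕ< n<)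
          (proj₂ (levelBound i) (fromℕ< n<)))
        (proj₂ leafBound i))

      arranged : Arrangement (Costs σ (algorithm A ω) N) 0 leaves
      arranged = arrangement₀ σ (algorithm A ω) N

      order : List (Fin (suc m))
      order = proj₁ arranged

      order↭ : order ↭ leaves
      order↭ = proj₁ (proj₂ arranged)

      stairs : Staircase (Costs σ (algorithm A ω) N) 0 order
      stairs = proj₂ (proj₂ arranged)

      length≡ : length order ≡ suc m
      length≡ = ≡.trans (↭-length order↭) (length-tabulate {n = suc m} id)

      -- If the cost were below `odd k` for some k ≤ n, the witnessing run would respect the step
      -- bound and so cost at least `odd n`, a contradiction. Hence all levels up to the rank `n`
      -- are active at `ω`.
      odd≤φ : ∀ {i n} → n ℕ.< length order → Costs σ (algorithm A ω) N i n →
        odd n ≤ value (φ i) ω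
      odd≤φ {i} {n} n< costs = L.odd≤levels i m (ℕ.s≤s⁻¹ n<′) (λ k k≤n →
        Equivalence.from T-not⇔ (λ b → proj₂ (proj₂ (run i k b))
          (≤-trans (odd-mono k≤n)
            (costs .total≥ (proj₁ (proj₂ (run i k b))) (steps≤N i k (ℕ.≤-<-trans k≤n n<′) b)))))
        where
        n<′ : n ℕ.< suc m
        n<′ = ≡.subst (n ℕ.<_) length≡ n<

-- The line and the star as instances

module LineSearch (𝓡 : Reals) where
  open Reals 𝓡
  open OrderedField 𝓡

  endpoint : Fin 2 → LinePoint
  endpoint zero       = minusOne
  endpoint (suc zero) = plusOne

  radius : ∀ i → FiniteMetricSpace.dist (line 𝓡) origin (endpoint i) ≈ 1#
  radius zero       = +-identityʳ 1#
  radius (suc zero) = +-identityʳ 1#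

  separated : ∀ {i j} → ¬ i ≡ j →
    fromℕ 2 ≤ FiniteMetricSpace.dist (line 𝓡) (endpoint i) (endpoint j)
  separated {zero}     {zero}     i≢j = contradiction ≡.refl i≢j
  separated {zero}     {suc zero} i≢j = ≤-refl
  separated {suc zero} {zero}     i≢j = ≤-refl
  separated {suc zero} {suc zero} i≢j = contradiction ≡.refl i≢j

  open BlindSearch 𝓡 (line 𝓡) origin 1 endpoint radius separated public
    using (deterministic; randomized)

module StarSearch (𝓡 : Reals) (m : ℕ) where
  open Reals 𝓡
  open OrderedField 𝓡
  open ≤-Reasoning

  radius : ∀ i → FiniteMetricSpace.dist (unitStar 𝓡 (suc m)) center (leaf i) ≈ 1#
  radius i = +-identityʳ 1#

  separated : ∀ {i j} → ¬ i ≡ j →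
    fromℕ 2 ≤ FiniteMetricSpace.dist (unitStar 𝓡 (suc m)) (leaf i) (leaf j)
  separated {i} {j} i≢j with i Fin.≟ j
  ... | yes i≡j = contradiction i≡j i≢j
  ... | no  _   = ≤-refl

  open BlindSearch 𝓡 (unitStar 𝓡 (suc m)) center m leaf radius separated public
    using (deterministic; randomized)

  2d-1≈odd : fromℕ 2 * fromℕ (suc m) - 1# ≈ odd m
  2d-1≈odd = begin-equality
    fromℕ 2 * fromℕ (suc m) - 1#   ≈⟨ +-congʳ (fromℕ-* 2 (suc m)) ⟨
    fromℕ (2 ℕ.* suc m) - 1#       ≡⟨ ≡.cong (λ l → fromℕ l - 1#) (double m) ⟩
    fromℕ (suc (m ℕ.+ m) ℕ.+ 1) - 1#  ≈⟨ +-congʳ (fromℕ-+ (suc (m ℕ.+ m)) 1) ⟩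
    odd m + fromℕ 1 - 1#           ≈⟨ +-assoc _ _ _ ⟩
    odd m + (fromℕ 1 - 1#)         ≈⟨ +-congˡ (≈-trans (+-congʳ (+-identityʳ 1#)) (-‿inverseʳ 1#)) ⟩
    odd m + 0#                     ≈⟨ +-identityʳ _ ⟩
    odd m                          ∎
    where
    double : ∀ m → 2 ℕ.* suc m ≡ suc (m ℕ.+ m) ℕ.+ 1
    double = solve-∀

theorem7p1 :
  (𝓡 : Reals) (σ : Service) →
  let open Reals 𝓡 in
  (let open Model 𝓡 (line 𝓡) origin
       open Randomized 𝓡 (line 𝓡) origin
   in
     ((A : Algorithm) →
        LowerBound (Competitive σ OneRequestAtZero A) (fromℕ 3))
     ×
     ((A : RandomizedAlgorithm) →
        LowerBound (CompetitiveInExpectation σ OneRequestAtZero A) (fromℕ 2)))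
  ×
  ((d : ℕ) → .{{_ : NonZero d}} →
   let open Model 𝓡 (unitStar 𝓡 d) center
       open Randomized 𝓡 (unitStar 𝓡 d) center
   in
     ((A : Algorithm) →
        LowerBound (Competitive σ OneRequestAtZero A) (fromℕ 2 * fromℕ d - 1#))
     ×
     ((A : RandomizedAlgorithm) →
        LowerBound (CompetitiveInExpectation σ OneRequestAtZero A) (fromℕ d)))
theorem7p1 𝓡 σ =
  -- With two leaves, `odd 1` computes to `fromℕ 3`; only for the star does 2d - 1 have to be
  -- converted.
  (LineSearch.deterministic 𝓡 σ , LineSearch.randomized 𝓡 σ) ,
  λ { (suc m) → (λ A ρ competitive → OrderedField.≤-respˡ-≈ 𝓡
                  (OrderedField.≈-sym 𝓡 (StarSearch.2d-1≈odd 𝓡 m))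
                  (StarSearch.deterministic 𝓡 m σ A ρ competitive))
              , StarSearch.randomized 𝓡 m σ }
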